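{- Let $\mathcal T$ be a theory of the semi-effect calculus SEC, let $\rhd:\mathcal V\to\mathcal C$ be a strong $\mathcal V$-equivariant functor where $\mathcal V$ is a category with finite products and $\mathcal C$ is a $\mathcal V$-actegory (with respect to the cartesian monoidal structure of $\mathcal V$), and let $[\![-]\!]$ be an interpretation of (the signature of) $\mathcal T$ in $\rhd$. Assume that every axiom of $\mathcal T$ is satisfied by $[\![-]\!]$. Then every equation-in-context derivable in $\mathcal T$ is satisfied by $[\![-]\!]$.
   Context: **Actegories.** Let $(\mathcal M,\otimes,I)$ be a monoidal category. An $\mathcal M$-action on a category $\mathcal C$ is a bifunctor $(-)\cdot(-):\mathcal M\times\mathcal C\to\mathcal C$ with natural isomorphisms $\eta_c:I\cdot c\to c$ and $\mu_{m_1,m_2,c}:(m_1\otimes m_2)\cdot c\to m_1\cdot(m_2\cdot c)$ such that (suppressing associators) $\mu_{m_1,m_2,m_3\cdot c}\circ\mu_{m_1\otimes m_2,m_3,c}=(\mathrm{id}\cdot\mu_{m_2,m_3,c})\circ\mu_{m_1,m_2\otimes m_3,c}$ and $(\mathrm{id}_m\cdot\eta_c)\circ\mu_{m,I,c}=r_m\cdot\mathrm{id}_c$, with $r_m:m\otimes I\to m$ the right unitor. An $\mathcal M$-actegory is a category with an $\mathcal M$-action. A functor $F:\mathcal C\to\mathcal D$ between $\mathcal M$-actegories is strong $\mathcal M$-equivariant if it is equipped with a natural isomorphism $\phi_{m,c}:m\cdot Fc\to F(m\cdot c)$ such that $F\mu_{m,m',c}\circ\phi_{m\otimes m',c}=\phi_{m,m'\cdot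 c}\circ(\mathrm{id}\cdot\phi_{m',c})\circ\mu_{m,m',Fc}$ and $F\eta_c\circ\phi_{I,c}=\eta_{Fc}$. **Syntax of SEC.** A signature consists of a set of base value types $\sigma$, a set of base computation types $b$, and a set of function symbols. Value types: $\tau::=\sigma\mid\tau\times\tau\mid 1$. Computation types: $A::=b\mid\rhd\tau$. Each function symbol has a sort of one of the forms $f:\tau_1,\dots,\tau_n\to\tau$, $g:\tau_1,\dots,\tau_n,A\to A'$, $h:\tau_1,\dots,\tau_n\to A$. A value context $\Gamma$ is a finite list of distinct typed value variables $x:\tau$; a computation context $\Delta$ is either empty (written $\cdot$) or a single typed computation variable $v:A$. Judgments are $\Gamma\vdash_v M:\tau$ and $\Gamma\mid\Delta\vdash_c N:A$, generated as follows. - Value terms: $\Gamma\vdash_v x:\tau$ if $(x:\tau)\in\Gamma$; if $\Gamma\vdash_v M_i:\tau_i$ for all $i$ then $\Gamma\vdash_v f(M_1,\dots,M_n):\tau$; plus the usual rules for pairing, projections and the unit term for $\times,1$. - $\Gamma\mid v:A\vdash_c v:A$. - If $\Gamma\vdash_v M_i:\tau_i$ for all $i$ and $\Gamma\mid\Delta\vdash_c N:A$, then $\Gamma\mid\Delta\vdash_c g(M_1,\dots,M_n,N):A'$. - If $\Gamma\vdash_v M_i:\tau_i$ for all $i$, then $\Gamma\mid\cdot\vdash_c h(M_1,\dots,M_n):A$. - If $\Gamma\vdash_v M:\tau$ then $\Gamma\mid\cdot\vdash_c\mathtt{val}\,M:\rhd\tau$. - If $\Gamma\mid\Delta\vdash_c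 N_1:\rhd\tau$ and $x:\tau,\Gamma\mid\cdot\vdash_c N_2:A$, then $\Gamma\mid\Delta\vdash_c(\mathtt{let\ val}\ x=N_1\ \mathtt{in}\ N_2):A$. **Theories and derivability.** An equation-in-context relates two terms of the same type in the same context; only such equations are considered. A theory is a signature together with a set of well-formed equations-in-context (axioms). The derivable equations are those generated by the axioms, congruence, reflexivity, symmetry, transitivity, substitution (of value terms for value variables and of computation terms for the computation variable), the usual $\beta\eta$-laws of finite products for value terms, and: - ($\beta$) $\Gamma\mid\cdot\vdash_c(\mathtt{let\ val}\ x=\mathtt{val}\,M\ \mathtt{in}\ N)=_A N[M/x]$ whenever $\Gamma\vdash_v M:\tau$ and $x:\tau,\Gamma\mid\cdot\vdash_c N:A$; - ($\eta$) $\Gamma\mid\Delta\vdash_c(\mathtt{let\ val}\ x=N\ \mathtt{in}\ \mathtt{val}\,x)=_{\rhd\tau}N$ whenever $\Gamma\mid\Delta\vdash_c N:\rhd\tau$; - (commuting conversion) $\Gamma\mid\Delta\vdash_c(\mathtt{let\ val}\ x=C[N_1]\ \mathtt{in}\ N_2)=_A C[\mathtt{let\ val}\ x=N_1\ \mathtt{in}\ N_2]$ whenever $\Gamma\mid\Delta\vdash_c N_1:\rhd\tau$ and $x:\tau,\Gamma\mid\cdot\vdash_c N_2:A$, where $C[-]$ is any typed context (a term with a hole). **Interpretation.** Let $\rhd:\mathcal V\to\mathcal C$ be as in the claim, with structure isomorphism $\phi$. An interpretation assigns an object of $\mathcal V$ to each base value type and an object of $\mathcal C$ to each base computation type, extended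 by $[\![\tau\times\tau']\!]=[\![\tau]\!]\times[\![\tau']\!]$, $[\![1]\!]=1$, $[\![\rhd\tau]\!]=\rhd[\![\tau]\!]$, $[\![\Gamma]\!]=\prod_{(x_i:\tau_i)\in\Gamma}[\![\tau_i]\!]$, $[\![\Gamma\mid v:A]\!]=[\![\Gamma]\!]\cdot[\![A]\!]$, $[\![\Gamma\mid\cdot]\!]=\rhd[\![\Gamma]\!]$; and morphisms $[\![f]\!]:\prod_i[\![\tau_i]\!]\to[\![\tau]\!]$ in $\mathcal V$, $[\![g]\!]:(\prod_i[\![\tau_i]\!])\cdot[\![A]\!]\to[\![A']\!]$ and $[\![h]\!]:\rhd(\prod_i[\![\tau_i]\!])\to[\![A]\!]$ in $\mathcal C$ to function symbols of the three sorts. Value terms are interpreted in $\mathcal V$ as usual in a category with finite products. Let $\delta$ be the diagonal of $[\![\Gamma]\!]$ and let $d:[\![\Gamma\mid\Delta]\!]\to[\![\Gamma]\!]\cdot[\![\Gamma\mid\Delta]\!]$ be $\phi^{ -1}\circ\rhd\delta$ if $\Delta$ is empty and $\mu\circ(\delta\cdot\mathrm{id})$ if $\Delta=(v:A)$. Computation terms are interpreted as morphisms $[\![\Gamma\mid\Delta]\!]\to[\![A]\!]$ by: $[\![v]\!]=\eta\circ(!\cdot\mathrm{id}):[\![\Gamma]\!]\cdot[\![A]\!]\to 1\cdot[\![A]\!]\to[\![A]\!]$; $[\![\mathtt{val}\,M]\!]=\rhd[\![M]\!]$; $[\![\mathtt{let\ val}\ x=N_1\ \mathtt{in}\ N_2]\!]=[\![N_2]\!]\circ\phi\circ(\mathrm{id}\cdot[\![N_1]\!])\circ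 d$ (identifying $[\![\Gamma]\!]\times[\![\tau]\!]$ with $[\![x:\tau,\Gamma]\!]$); $[\![g(M_1,\dots,M_n,N)]\!]=[\![g]\!]\circ(\langle[\![M_1]\!],\dots,[\![M_n]\!]\rangle\cdot[\![N]\!])\circ d$; $[\![h(M_1,\dots,M_n)]\!]=[\![h]\!]\circ\rhd\langle[\![M_1]\!],\dots,[\![M_n]\!]\rangle$. An equation-in-context is satisfied by $[\![-]\!]$ if both sides are interpreted by the same morphism.
   Formalization: In the commuting conversion, C[-] ranges only over contexts typed uniformly in the hole type (hole in let bodies), since for C = g([-]) the rule is unsound; for other hole positions the rule C[let val x=N1 in N2] = let val x=N1 in C[N2] is added. -}

module Defs where

open import Level using (Level; _⊔_) renaming (suc to lsuc)
open import Data.List.Base using (List; []; _∷_)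
open import Data.List.Membership.Propositional using (_∈_)
open import Data.List.Relation.Binary.Subset.Propositional using (_⊆_)
open import Data.List.Relation.Unary.All using (All; []; _∷_; lookup)
open import Data.List.Relation.Unary.Any using (here; there)
open import Data.Maybe.Base using (Maybe; just; nothing)
open import Data.Product.Base using (_×_; _,_; proj₁; proj₂)
open import Relation.Binary.Bundles using (Setoid)
open import Relation.Binary.PropositionalEquality.Core using (refl)
open import Relation.Binary.Structures using (IsEquivalence)
import Relation.Binary.Reasoning.Setoid as SetoidReasoning

------------------------------------------------------------------------
-- Categories (hom-setoids), functors, isomorphisms

record Category (o ℓ e : Level) : Set (lsuc (o ⊔ ℓ ⊔ e)) where
  infix  4 _≈_ _⇒_
  infixr 9 _∘_
  field
    Obj : Set o
    _⇒_ : Obj → Obj → Set ℓ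
    _≈_ : ∀ {A B} → A ⇒ B → A ⇒ B → Set e
    id  : ∀ {A} → A ⇒ A
    _∘_ : ∀ {A B C} → B ⇒ C → A ⇒ B → A ⇒ C
    assoc     : ∀ {A B C D} {f : A ⇒ B} {g : B ⇒ C} {h : C ⇒ D} →
                (h ∘ g) ∘ f ≈ h ∘ (g ∘ f)
    identityˡ : ∀ {A B} {f : A ⇒ B} → id ∘ f ≈ f
    identityʳ : ∀ {A B} {f : A ⇒ B} → f ∘ id ≈ f
    equiv     : ∀ {A B} → IsEquivalence (_≈_ {A} {B})
    ∘-resp-≈  : ∀ {A B C} {f h : B ⇒ C} {g i : A ⇒ B} →
                f ≈ h → g ≈ i → f ∘ g ≈ h ∘ i

  module Equiv {A B : Obj} = IsEquivalence (equiv {A} {B})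

  homSetoid : Obj → Obj → Setoid ℓ e
  homSetoid A B = record { Carrier = A ⇒ B ; _≈_ = _≈_ ; isEquivalence = equiv }

  ∘-resp-≈ˡ : ∀ {A B C} {f h : B ⇒ C} {g : A ⇒ B} → f ≈ h → f ∘ g ≈ h ∘ g
  ∘-resp-≈ˡ p = ∘-resp-≈ p Equiv.refl

  ∘-resp-≈ʳ : ∀ {A B C} {f : B ⇒ C} {g i : A ⇒ B} → g ≈ i → f ∘ g ≈ f ∘ i
  ∘-resp-≈ʳ p = ∘-resp-≈ Equiv.refl p

  record Iso (A B : Obj) : Set (ℓ ⊔ e) where
    field
      from : A ⇒ B
      to   : B ⇒ A
      isoˡ : to ∘ from ≈ id
      isoʳ : from ∘ to ≈ id

record Functor {o ℓ e o′ ℓ′ e′ : Level}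
               (C : Category o ℓ e) (D : Category o′ ℓ′ e′) :
               Set (o ⊔ ℓ ⊔ e ⊔ o′ ⊔ ℓ′ ⊔ e′) where
  private
    module C = Category C
    module D = Category D
  field
    F₀ : C.Obj → D.Obj
    F₁ : ∀ {A B} → A C.⇒ B → F₀ A D.⇒ F₀ B
    identity     : ∀ {A} → F₁ (C.id {A}) D.≈ D.id
    homomorphism : ∀ {X Y Z} {f : X C.⇒ Y} {g : Y C.⇒ Z} →
                   F₁ (g C.∘ f) D.≈ F₁ g D.∘ F₁ f
    F-resp-≈     : ∀ {A B} {f g : A C.⇒ B} → f C.≈ g → F₁ f D.≈ F₁ g

ProductCategory : ∀ {o ℓ e o′ ℓ′ e′} → Category o ℓ e → Category o′ ℓ′ e′ →
                  Category (o ⊔ o′) (ℓ ⊔ ℓ′) (e ⊔ e′)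
ProductCategory C D = record
  { Obj       = C.Obj × D.Obj
  ; _⇒_       = λ X Y → (proj₁ X C.⇒ proj₁ Y) × (proj₂ X D.⇒ proj₂ Y)
  ; _≈_       = λ f g → (proj₁ f C.≈ proj₁ g) × (proj₂ f D.≈ proj₂ g)
  ; id        = C.id , D.id
  ; _∘_       = λ f g → (proj₁ f C.∘ proj₁ g) , (proj₂ f D.∘ proj₂ g)
  ; assoc     = C.assoc , D.assoc
  ; identityˡ = C.identityˡ , D.identityˡ
  ; identityʳ = C.identityʳ , D.identityʳ
  ; equiv     = record
    { refl  = C.Equiv.refl , D.Equiv.refl
    ; sym   = λ p → C.Equiv.sym (proj₁ p) , D.Equiv.sym (proj₂ p)
    ; trans = λ p q → C.Equiv.trans (proj₁ p) (proj₁ q) ,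
                      D.Equiv.trans (proj₂ p) (proj₂ q)
    }
  ; ∘-resp-≈  = λ p q → C.∘-resp-≈ (proj₁ p) (proj₁ q) ,
                        D.∘-resp-≈ (proj₂ p) (proj₂ q)
  }
  where
  module C = Category C
  module D = Category D

Bifunctor : ∀ {o ℓ e o′ ℓ′ e′ o″ ℓ″ e″} →
            Category o ℓ e → Category o′ ℓ′ e′ → Category o″ ℓ″ e″ →
            Set (o ⊔ ℓ ⊔ e ⊔ o′ ⊔ ℓ′ ⊔ e′ ⊔ o″ ⊔ ℓ″ ⊔ e″)
Bifunctor A B C = Functor (ProductCategory A B) C

------------------------------------------------------------------------
-- Monoidal categories, actegories, strong equivariant functors

record Monoidal {o ℓ e : Level} (M : Category o ℓ e) : Set (o ⊔ ℓ ⊔ e) where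
  open Category M
  field
    tensor : Bifunctor M M M
    unit   : Obj

  infixr 10 _⊗₀_ _⊗₁_

  _⊗₀_ : Obj → Obj → Obj
  A ⊗₀ B = Functor.F₀ tensor (A , B)

  _⊗₁_ : ∀ {A B A′ B′} → A ⇒ A′ → B ⇒ B′ → A ⊗₀ B ⇒ A′ ⊗₀ B′
  f ⊗₁ g = Functor.F₁ tensor (f , g)

  field
    leftUnitor  : ∀ A → Iso (unit ⊗₀ A) A
    rightUnitor : ∀ A → Iso (A ⊗₀ unit) A
    associator  : ∀ A B C → Iso ((A ⊗₀ B) ⊗₀ C) (A ⊗₀ (B ⊗₀ C))

  λ⇒ : ∀ A → unit ⊗₀ A ⇒ A
  λ⇒ A = Iso.from (leftUnitor A)

  ρ⇒ : ∀ A → A ⊗₀ unit ⇒ A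
  ρ⇒ A = Iso.from (rightUnitor A)

  α⇒ : ∀ A B C → (A ⊗₀ B) ⊗₀ C ⇒ A ⊗₀ (B ⊗₀ C)
  α⇒ A B C = Iso.from (associator A B C)

  field
    λ-natural : ∀ {A B} (f : A ⇒ B) → f ∘ λ⇒ A ≈ λ⇒ B ∘ (id ⊗₁ f)
    ρ-natural : ∀ {A B} (f : A ⇒ B) → f ∘ ρ⇒ A ≈ ρ⇒ B ∘ (f ⊗₁ id)
    α-natural : ∀ {A B C A′ B′ C′}
                (f : A ⇒ A′) (g : B ⇒ B′) (h : C ⇒ C′) →
                (f ⊗₁ (g ⊗₁ h)) ∘ α⇒ A B C ≈ α⇒ A′ B′ C′ ∘ ((f ⊗₁ g) ⊗₁ h)
    triangle  : ∀ A B → (id ⊗₁ λ⇒ B) ∘ α⇒ A unit B ≈ ρ⇒ A ⊗₁ id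
    pentagon  : ∀ A B C D →
                α⇒ A B (C ⊗₀ D) ∘ α⇒ (A ⊗₀ B) C D
                ≈ (id ⊗₁ α⇒ B C D) ∘ (α⇒ A (B ⊗₀ C) D ∘ (α⇒ A B C ⊗₁ id))

record Action {o ℓ e o′ ℓ′ e′ : Level}
              {M : Category o ℓ e} (⊗ : Monoidal M) (C : Category o′ ℓ′ e′) :
              Set (o ⊔ ℓ ⊔ e ⊔ o′ ⊔ ℓ′ ⊔ e′) where
  private
    module M = Category M
    module ⊗ = Monoidal ⊗
  open Category C
  field
    act : Bifunctor M C C

  infixr 10 _·₀_ _·₁_

  _·₀_ : M.Obj → Obj → Obj
  m ·₀ c = Functor.F₀ act (m , c)

  _·₁_ : ∀ {m n c d} → m M.⇒ n → c ⇒ d → m ·₀ c ⇒ n ·₀ d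
  f ·₁ g = Functor.F₁ act (f , g)

  field
    unitIso : ∀ c → Iso (⊗.unit ·₀ c) c
    multIso : ∀ m n c → Iso ((m ⊗.⊗₀ n) ·₀ c) (m ·₀ (n ·₀ c))

  η : ∀ c → ⊗.unit ·₀ c ⇒ c
  η c = Iso.from (unitIso c)

  μ : ∀ m n c → (m ⊗.⊗₀ n) ·₀ c ⇒ m ·₀ (n ·₀ c)
  μ m n c = Iso.from (multIso m n c)

  field
    η-natural : ∀ {c d} (f : c ⇒ d) → f ∘ η c ≈ η d ∘ (M.id ·₁ f)
    μ-natural : ∀ {m n c m′ n′ c′} (f : m M.⇒ m′) (g : n M.⇒ n′) (h : c ⇒ c′) →
                (f ·₁ (g ·₁ h)) ∘ μ m n c ≈ μ m′ n′ c′ ∘ ((f ⊗.⊗₁ g) ·₁ h)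
    assoc-coh : ∀ m₁ m₂ m₃ c →
                μ m₁ m₂ (m₃ ·₀ c) ∘ μ (m₁ ⊗.⊗₀ m₂) m₃ c
                ≈ (M.id ·₁ μ m₂ m₃ c) ∘
                  (μ m₁ (m₂ ⊗.⊗₀ m₃) c ∘ (⊗.α⇒ m₁ m₂ m₃ ·₁ id))
    unit-coh  : ∀ m c → (M.id ·₁ η c) ∘ μ m ⊗.unit c ≈ ⊗.ρ⇒ m ·₁ id

selfAction : ∀ {o ℓ e} {M : Category o ℓ e} (⊗ : Monoidal M) → Action ⊗ M
selfAction ⊗ = record
  { act       = tensor
  ; unitIso   = leftUnitor
  ; multIso   = associator
  ; η-natural = λ-natural
  ; μ-natural = α-natural
  ; assoc-coh = pentagon
  ; unit-coh  = triangle
  }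
  where open Monoidal ⊗

record StrongEquivariant
  {o ℓ e o₁ ℓ₁ e₁ o₂ ℓ₂ e₂ : Level} {M : Category o ℓ e} {⊗ : Monoidal M}
  {C : Category o₁ ℓ₁ e₁} {D : Category o₂ ℓ₂ e₂}
  (actC : Action ⊗ C) (actD : Action ⊗ D) (F : Functor C D) :
  Set (o ⊔ ℓ ⊔ e ⊔ o₁ ⊔ ℓ₁ ⊔ e₁ ⊔ o₂ ⊔ ℓ₂ ⊔ e₂) where
  private
    module M = Category M
    module ⊗ = Monoidal ⊗
    module C = Category C
    module AC = Action actC
    module AD = Action actD
  open Category D
  open Functor F
  field
    φ-iso : ∀ m c → Iso (m AD.·₀ F₀ c) (F₀ (m AC.·₀ c))

  φ : ∀ m c → m AD.·₀ F₀ c ⇒ F₀ (m AC.·₀ c)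
  φ m c = Iso.from (φ-iso m c)

  φ⁻¹ : ∀ m c → F₀ (m AC.·₀ c) ⇒ m AD.·₀ F₀ c
  φ⁻¹ m c = Iso.to (φ-iso m c)

  field
    φ-natural : ∀ {m n c d} (f : m M.⇒ n) (g : c C.⇒ d) →
                F₁ (f AC.·₁ g) ∘ φ m c ≈ φ n d ∘ (f AD.·₁ F₁ g)
    φ-mult    : ∀ m n c →
                F₁ (AC.μ m n c) ∘ φ (m ⊗.⊗₀ n) c
                ≈ φ m (n AC.·₀ c) ∘ ((M.id AD.·₁ φ n c) ∘ AD.μ m n (F₀ c))
    φ-unit    : ∀ c → F₁ (AC.η c) ∘ φ ⊗.unit c ≈ AD.η (F₀ c)

------------------------------------------------------------------------
-- Finite products and the cartesian monoidal structure

record FiniteProducts {o ℓ e : Level} (V : Category o ℓ e) :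
                      Set (o ⊔ ℓ ⊔ e) where
  open Category V
  infixr 10 _⊠_ _⊠₁_
  field
    𝟙        : Obj
    !        : ∀ {A} → A ⇒ 𝟙
    !-unique : ∀ {A} (f : A ⇒ 𝟙) → f ≈ !
    _⊠_      : Obj → Obj → Obj
    π₁       : ∀ {A B} → A ⊠ B ⇒ A
    π₂       : ∀ {A B} → A ⊠ B ⇒ B
    ⟨_,_⟩    : ∀ {A B C} → C ⇒ A → C ⇒ B → C ⇒ A ⊠ B
    project₁ : ∀ {A B C} {f : C ⇒ A} {g : C ⇒ B} → π₁ ∘ ⟨ f , g ⟩ ≈ f
    project₂ : ∀ {A B C} {f : C ⇒ A} {g : C ⇒ B} → π₂ ∘ ⟨ f , g ⟩ ≈ g
    unique   : ∀ {A B C} {f : C ⇒ A} {g : C ⇒ B} {h : C ⇒ A ⊠ B} →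
               π₁ ∘ h ≈ f → π₂ ∘ h ≈ g → h ≈ ⟨ f , g ⟩

  δ : ∀ {A} → A ⇒ A ⊠ A
  δ = ⟨ id , id ⟩

  _⊠₁_ : ∀ {A B A′ B′} → A ⇒ A′ → B ⇒ B′ → A ⊠ B ⇒ A′ ⊠ B′
  f ⊠₁ g = ⟨ f ∘ π₁ , g ∘ π₂ ⟩

module _ {o ℓ e : Level} {V : Category o ℓ e} (P : FiniteProducts V) where
  open Category V
  open FiniteProducts P
  private
    module Eq {A B : Obj} = SetoidReasoning (homSetoid A B)

    !-unique₂ : ∀ {A} {f g : A ⇒ 𝟙} → f ≈ g
    !-unique₂ {f = f} {g} = Equiv.trans (!-unique f) (Equiv.sym (!-unique g))

    ⊠-ext : ∀ {A B C} {f g : C ⇒ A ⊠ B} →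
            π₁ ∘ f ≈ π₁ ∘ g → π₂ ∘ f ≈ π₂ ∘ g → f ≈ g
    ⊠-ext p q = Equiv.trans (unique p q)
                            (Equiv.sym (unique Equiv.refl Equiv.refl))

    ⟨⟩-cong : ∀ {A B C} {f f′ : C ⇒ A} {g g′ : C ⇒ B} →
              f ≈ f′ → g ≈ g′ → ⟨ f , g ⟩ ≈ ⟨ f′ , g′ ⟩
    ⟨⟩-cong p q = unique (Equiv.trans project₁ p) (Equiv.trans project₂ q)

    ⟨⟩∘ : ∀ {A B C D} {f : C ⇒ A} {g : C ⇒ B} {h : D ⇒ C} →
          ⟨ f , g ⟩ ∘ h ≈ ⟨ f ∘ h , g ∘ h ⟩
    ⟨⟩∘ = unique (Equiv.trans (Equiv.sym assoc) (∘-resp-≈ˡ project₁))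
                 (Equiv.trans (Equiv.sym assoc) (∘-resp-≈ˡ project₂))

    ⟨⟩-η : ∀ {A B} → ⟨ π₁ , π₂ ⟩ ≈ id {A ⊠ B}
    ⟨⟩-η = Equiv.sym (unique identityʳ identityʳ)

    ⊠₁∘⟨⟩ : ∀ {A B A′ B′ C} {f : A ⇒ A′} {g : B ⇒ B′} {h : C ⇒ A} {k : C ⇒ B} →
            (f ⊠₁ g) ∘ ⟨ h , k ⟩ ≈ ⟨ f ∘ h , g ∘ k ⟩
    ⊠₁∘⟨⟩ = Equiv.trans ⟨⟩∘
      (⟨⟩-cong (Equiv.trans assoc (∘-resp-≈ʳ project₁))
               (Equiv.trans assoc (∘-resp-≈ʳ project₂)))

    project₁∘ : ∀ {A B C D} {f : C ⇒ A} {g : C ⇒ B} {h : A ⇒ D} →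
                (h ∘ π₁) ∘ ⟨ f , g ⟩ ≈ h ∘ f
    project₁∘ = Equiv.trans assoc (∘-resp-≈ʳ project₁)

    project₂∘ : ∀ {A B C D} {f : C ⇒ A} {g : C ⇒ B} {h : B ⇒ D} →
                (h ∘ π₂) ∘ ⟨ f , g ⟩ ≈ h ∘ g
    project₂∘ = Equiv.trans assoc (∘-resp-≈ʳ project₂)

    α : ∀ A B C → (A ⊠ B) ⊠ C ⇒ A ⊠ (B ⊠ C)
    α A B C = ⟨ π₁ ∘ π₁ , ⟨ π₂ ∘ π₁ , π₂ ⟩ ⟩

    α⁻¹ : ∀ A B C → A ⊠ (B ⊠ C) ⇒ (A ⊠ B) ⊠ C
    α⁻¹ A B C = ⟨ ⟨ π₁ , π₁ ∘ π₂ ⟩ , π₂ ∘ π₂ ⟩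

    α∘⟨⟩ : ∀ {A B C D} {f : D ⇒ A ⊠ B} {h : D ⇒ C} →
           α A B C ∘ ⟨ f , h ⟩ ≈ ⟨ π₁ ∘ f , ⟨ π₂ ∘ f , h ⟩ ⟩
    α∘⟨⟩ = Equiv.trans ⟨⟩∘ (⟨⟩-cong project₁∘
      (Equiv.trans ⟨⟩∘ (⟨⟩-cong project₁∘ project₂)))

    α∘ : ∀ {A B C D} {h : D ⇒ (A ⊠ B) ⊠ C} →
         α A B C ∘ h ≈ ⟨ π₁ ∘ (π₁ ∘ h) , ⟨ π₂ ∘ (π₁ ∘ h) , π₂ ∘ h ⟩ ⟩
    α∘ = Equiv.trans ⟨⟩∘ (⟨⟩-cong assoc (Equiv.trans ⟨⟩∘ (⟨⟩-cong assoc Equiv.refl)))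

    α-iso : ∀ A B C → Iso ((A ⊠ B) ⊠ C) (A ⊠ (B ⊠ C))
    α-iso A B C = record
      { from = α A B C
      ; to   = α⁻¹ A B C
      ; isoˡ = begin
          α⁻¹ A B C ∘ α A B C
            ≈⟨ ⟨⟩∘ ⟩
          ⟨ ⟨ π₁ , π₁ ∘ π₂ ⟩ ∘ α A B C , (π₂ ∘ π₂) ∘ α A B C ⟩
            ≈⟨ ⟨⟩-cong (Equiv.trans ⟨⟩∘ (⟨⟩-cong project₁
                 (Equiv.trans project₂∘ project₁)))
                 (Equiv.trans project₂∘ project₂) ⟩
          ⟨ ⟨ π₁ ∘ π₁ , π₂ ∘ π₁ ⟩ , π₂ ⟩
            ≈⟨ ⟨⟩-cong (Equiv.trans (Equiv.sym ⟨⟩∘)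
                 (Equiv.trans (∘-resp-≈ˡ ⟨⟩-η) identityˡ)) Equiv.refl ⟩
          ⟨ π₁ , π₂ ⟩
            ≈⟨ ⟨⟩-η ⟩
          id ∎
      ; isoʳ = begin
          α A B C ∘ α⁻¹ A B C
            ≈⟨ α∘⟨⟩ ⟩
          ⟨ π₁ ∘ ⟨ π₁ , π₁ ∘ π₂ ⟩ , ⟨ π₂ ∘ ⟨ π₁ , π₁ ∘ π₂ ⟩ , π₂ ∘ π₂ ⟩ ⟩
            ≈⟨ ⟨⟩-cong project₁ (⟨⟩-cong project₂ Equiv.refl) ⟩
          ⟨ π₁ , ⟨ π₁ ∘ π₂ , π₂ ∘ π₂ ⟩ ⟩
            ≈⟨ ⟨⟩-cong Equiv.refl (Equiv.trans (Equiv.sym ⟨⟩∘)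
                 (Equiv.trans (∘-resp-≈ˡ ⟨⟩-η) identityˡ)) ⟩
          ⟨ π₁ , π₂ ⟩
            ≈⟨ ⟨⟩-η ⟩
          id ∎
      }
      where open Eq

    α-nat : ∀ {A B C A′ B′ C′} (f : A ⇒ A′) (g : B ⇒ B′) (h : C ⇒ C′) →
            (f ⊠₁ (g ⊠₁ h)) ∘ α A B C ≈ α A′ B′ C′ ∘ ((f ⊠₁ g) ⊠₁ h)
    α-nat {A} {B} {C} {A′} {B′} {C′} f g h = begin
      (f ⊠₁ (g ⊠₁ h)) ∘ α A B C
        ≈⟨ Equiv.trans ⊠₁∘⟨⟩ (⟨⟩-cong Equiv.refl ⊠₁∘⟨⟩) ⟩
      ⟨ f ∘ (π₁ ∘ π₁) , ⟨ g ∘ (π₂ ∘ π₁) , h ∘ π₂ ⟩ ⟩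
        ≈⟨ ⟨⟩-cong (proj project₁) (⟨⟩-cong (proj project₂) Equiv.refl) ⟨
      ⟨ π₁ ∘ ((f ⊠₁ g) ∘ π₁) , ⟨ π₂ ∘ ((f ⊠₁ g) ∘ π₁) , h ∘ π₂ ⟩ ⟩
        ≈⟨ α∘⟨⟩ ⟨
      α A′ B′ C′ ∘ ((f ⊠₁ g) ⊠₁ h) ∎
      where
      open Eq
      proj : ∀ {X Y Z W U} {p : Y ⇒ Z} {q : X ⇒ Y} {k : W ⇒ Z} {l : X ⇒ W}
             {m : U ⇒ X} → p ∘ q ≈ k ∘ l → p ∘ (q ∘ m) ≈ k ∘ (l ∘ m)
      proj eq = Equiv.trans (Equiv.sym assoc) (Equiv.trans (∘-resp-≈ˡ eq) assoc)

    pent : ∀ A B C D →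
           α A B (C ⊠ D) ∘ α (A ⊠ B) C D
           ≈ (id ⊠₁ α B C D) ∘ (α A (B ⊠ C) D ∘ (α A B C ⊠₁ id))
    pent A B C D = begin
      α A B (C ⊠ D) ∘ α (A ⊠ B) C D
        ≈⟨ α∘⟨⟩ ⟩
      ⟨ π₁ ∘ (π₁ ∘ π₁) , ⟨ π₂ ∘ (π₁ ∘ π₁) , ⟨ π₂ ∘ π₁ , π₂ ⟩ ⟩ ⟩
        ≈⟨ ⟨⟩-cong left (Equiv.trans α∘⟨⟩
             (⟨⟩-cong mid₁ (⟨⟩-cong mid₂ identityˡ))) ⟨
      ⟨ id ∘ (π₁ ∘ (α A B C ∘ π₁))
      , α B C D ∘ ⟨ π₂ ∘ (α A B C ∘ π₁) , id ∘ π₂ ⟩ ⟩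
        ≈⟨ ⊠₁∘⟨⟩ ⟨
      (id ⊠₁ α B C D) ∘
        ⟨ π₁ ∘ (α A B C ∘ π₁) , ⟨ π₂ ∘ (α A B C ∘ π₁) , id ∘ π₂ ⟩ ⟩
        ≈⟨ ∘-resp-≈ʳ α∘⟨⟩ ⟨
      (id ⊠₁ α B C D) ∘ (α A (B ⊠ C) D ∘ (α A B C ⊠₁ id)) ∎
      where
      open Eq
      left : id ∘ (π₁ ∘ (α A B C ∘ π₁ {(A ⊠ B) ⊠ C} {D})) ≈ π₁ ∘ (π₁ ∘ π₁)
      left = Equiv.trans identityˡ (Equiv.trans (Equiv.sym assoc)
               (Equiv.trans (∘-resp-≈ˡ project₁) assoc))
      α₂ : π₂ ∘ (α A B C ∘ π₁ {(A ⊠ B) ⊠ C} {D})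
           ≈ ⟨ π₂ ∘ (π₁ ∘ π₁) , π₂ ∘ π₁ ⟩
      α₂ = Equiv.trans (∘-resp-≈ʳ α∘) project₂
      mid₁ : π₁ ∘ (π₂ ∘ (α A B C ∘ π₁ {(A ⊠ B) ⊠ C} {D})) ≈ π₂ ∘ (π₁ ∘ π₁)
      mid₁ = Equiv.trans (∘-resp-≈ʳ α₂) project₁
      mid₂ : π₂ ∘ (π₂ ∘ (α A B C ∘ π₁ {(A ⊠ B) ⊠ C} {D})) ≈ π₂ ∘ π₁
      mid₂ = Equiv.trans (∘-resp-≈ʳ α₂) project₂

  cartesian : Monoidal V
  cartesian = record
    { tensor = record
      { F₀           = λ X → proj₁ X ⊠ proj₂ X
      ; F₁           = λ f → proj₁ f ⊠₁ proj₂ f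
      ; identity     = Equiv.trans (⟨⟩-cong identityˡ identityˡ) ⟨⟩-η
      ; homomorphism = Equiv.sym (Equiv.trans ⊠₁∘⟨⟩
                         (⟨⟩-cong (Equiv.sym assoc) (Equiv.sym assoc)))
      ; F-resp-≈     = λ p → ⟨⟩-cong (∘-resp-≈ˡ (proj₁ p)) (∘-resp-≈ˡ (proj₂ p))
      }
    ; unit        = 𝟙
    ; leftUnitor  = λ A → record
      { from = π₂
      ; to   = ⟨ ! , id ⟩
      ; isoˡ = Equiv.trans ⟨⟩∘ (Equiv.sym (unique !-unique₂
                 (Equiv.trans identityʳ (Equiv.sym identityˡ))))
      ; isoʳ = project₂
      }
    ; rightUnitor = λ A → record
      { from = π₁
      ; to   = ⟨ id , ! ⟩
      ; isoˡ = Equiv.trans ⟨⟩∘ (Equiv.sym (unique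
                 (Equiv.trans identityʳ (Equiv.sym identityˡ)) !-unique₂))
      ; isoʳ = project₁
      }
    ; associator  = α-iso
    ; λ-natural   = λ f → Equiv.sym project₂
    ; ρ-natural   = λ f → Equiv.sym project₁
    ; α-natural   = α-nat
    ; triangle    = λ A B → Equiv.trans ⊠₁∘⟨⟩
                      (⟨⟩-cong identityˡ (Equiv.trans project₂ (Equiv.sym identityˡ)))
    ; pentagon    = pent
    }

------------------------------------------------------------------------
-- Signatures

infix 25 ▷_

data ValTy {s : Level} (BV : Set s) : Set s where
  base : BV → ValTy BV
  _`×_ : ValTy BV → ValTy BV → ValTy BV
  `1   : ValTy BV

data CompTy {s : Level} (BV BC : Set s) : Set s where
  base : BC → CompTy BV BC
  ▷_   : ValTy BV → CompTy BV BC

data Sort {s : Level} (BV BC : Set s) : Set s where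
  _⟶ᵛ_   : List (ValTy BV) → ValTy BV → Sort BV BC
  _⨾_⟶ᶜ_ : List (ValTy BV) → CompTy BV BC → CompTy BV BC → Sort BV BC
  _⟶ᶜ_   : List (ValTy BV) → CompTy BV BC → Sort BV BC

record Signature (s : Level) : Set (lsuc s) where
  field
    BaseV : Set s
    BaseC : Set s
    Fun   : Sort BaseV BaseC → Set s

------------------------------------------------------------------------
-- Terms: intrinsically typed, de Bruijn.  A computation context is
-- `nothing` (empty) or `just A` (one variable of type A).

module Syntax {s : Level} (S : Signature s) where
  open Signature S public

  VTy CTy VCtx CCtx : Set s
  VTy  = ValTy BaseV
  CTy  = CompTy BaseV BaseC
  VCtx = List VTy
  CCtx = Maybe CTy

  private variable
    Γ Γ′ Γ″ : VCtx
    Δ Δ′    : CCtx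
    σ τ τ′  : VTy
    τs      : List VTy
    A A′ B  : CTy

  infix 4 _⊢ᵛ_ _∣_⊢ᶜ_

  data _⊢ᵛ_ (Γ : VCtx) : VTy → Set s where
    var  : τ ∈ Γ → Γ ⊢ᵛ τ
    fun  : Fun (τs ⟶ᵛ τ) → All (Γ ⊢ᵛ_) τs → Γ ⊢ᵛ τ
    pair : Γ ⊢ᵛ τ → Γ ⊢ᵛ τ′ → Γ ⊢ᵛ τ `× τ′
    fst  : Γ ⊢ᵛ τ `× τ′ → Γ ⊢ᵛ τ
    snd  : Γ ⊢ᵛ τ `× τ′ → Γ ⊢ᵛ τ′
    unit : Γ ⊢ᵛ `1

  data _∣_⊢ᶜ_ (Γ : VCtx) : CCtx → CTy → Set s where
    cvar   : Γ ∣ just A ⊢ᶜ A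
    cfun   : Fun (τs ⨾ A ⟶ᶜ A′) → All (Γ ⊢ᵛ_) τs → Γ ∣ Δ ⊢ᶜ A → Γ ∣ Δ ⊢ᶜ A′
    gen    : Fun (τs ⟶ᶜ A) → All (Γ ⊢ᵛ_) τs → Γ ∣ nothing ⊢ᶜ A
    val    : Γ ⊢ᵛ τ → Γ ∣ nothing ⊢ᶜ ▷ τ
    letval : Γ ∣ Δ ⊢ᶜ ▷ τ → τ ∷ Γ ∣ nothing ⊢ᶜ A → Γ ∣ Δ ⊢ᶜ A

  lift : Γ ⊆ Γ′ → τ ∷ Γ ⊆ τ ∷ Γ′
  lift ρ (here p)  = here p
  lift ρ (there i) = there (ρ i)

  mutual
    renᵛ : Γ ⊆ Γ′ → Γ ⊢ᵛ τ → Γ′ ⊢ᵛ τ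
    renᵛ ρ (var i)    = var (ρ i)
    renᵛ ρ (fun f Ms) = fun f (ren* ρ Ms)
    renᵛ ρ (pair M N) = pair (renᵛ ρ M) (renᵛ ρ N)
    renᵛ ρ (fst M)    = fst (renᵛ ρ M)
    renᵛ ρ (snd M)    = snd (renᵛ ρ M)
    renᵛ ρ unit       = unit

    ren* : Γ ⊆ Γ′ → All (Γ ⊢ᵛ_) τs → All (Γ′ ⊢ᵛ_) τs
    ren* ρ []       = []
    ren* ρ (M ∷ Ms) = renᵛ ρ M ∷ ren* ρ Ms

  renᶜ : Γ ⊆ Γ′ → Γ ∣ Δ ⊢ᶜ A → Γ′ ∣ Δ ⊢ᶜ A
  renᶜ ρ cvar          = cvar
  renᶜ ρ (cfun g Ms N) = cfun g (ren* ρ Ms) (renᶜ ρ N)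
  renᶜ ρ (gen h Ms)    = gen h (ren* ρ Ms)
  renᶜ ρ (val M)       = val (renᵛ ρ M)
  renᶜ ρ (letval N N′) = letval (renᶜ ρ N) (renᶜ (lift ρ) N′)

  Sub : VCtx → VCtx → Set s
  Sub Γ Γ′ = ∀ {τ} → τ ∈ Γ → Γ′ ⊢ᵛ τ

  liftˢ : Sub Γ Γ′ → Sub (τ ∷ Γ) (τ ∷ Γ′)
  liftˢ θ (here p)  = var (here p)
  liftˢ θ (there i) = renᵛ there (θ i)

  mutual
    subᵛ : Sub Γ Γ′ → Γ ⊢ᵛ τ → Γ′ ⊢ᵛ τ
    subᵛ θ (var i)    = θ i
    subᵛ θ (fun f Ms) = fun f (sub* θ Ms)
    subᵛ θ (pair M N) = pair (subᵛ θ M) (subᵛ θ N)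
    subᵛ θ (fst M)    = fst (subᵛ θ M)
    subᵛ θ (snd M)    = snd (subᵛ θ M)
    subᵛ θ unit       = unit

    sub* : Sub Γ Γ′ → All (Γ ⊢ᵛ_) τs → All (Γ′ ⊢ᵛ_) τs
    sub* θ []       = []
    sub* θ (M ∷ Ms) = subᵛ θ M ∷ sub* θ Ms

  subᶜ : Sub Γ Γ′ → Γ ∣ Δ ⊢ᶜ A → Γ′ ∣ Δ ⊢ᶜ A
  subᶜ θ cvar          = cvar
  subᶜ θ (cfun g Ms N) = cfun g (sub* θ Ms) (subᶜ θ N)
  subᶜ θ (gen h Ms)    = gen h (sub* θ Ms)
  subᶜ θ (val M)       = val (subᵛ θ M)
  subᶜ θ (letval N N′) = letval (subᶜ θ N) (subᶜ (liftˢ θ) N′)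

  single : Γ ⊢ᵛ τ → Sub (τ ∷ Γ) Γ
  single M (here refl) = M
  single M (there i)   = var i

  infix 8 _[_]ᵛ _[_]ᶜ

  _[_]ᵛ : τ ∷ Γ ∣ Δ ⊢ᶜ A → Γ ⊢ᵛ τ → Γ ∣ Δ ⊢ᶜ A
  N [ M ]ᵛ = subᶜ (single M) N

  _[_]ᶜ : Γ ∣ just A ⊢ᶜ B → Γ ∣ Δ ⊢ᶜ A → Γ ∣ Δ ⊢ᶜ B
  cvar          [ P ]ᶜ = P
  (cfun g Ms N) [ P ]ᶜ = cfun g Ms (N [ P ]ᶜ)
  (letval N N′) [ P ]ᶜ = letval (N [ P ]ᶜ) N′

  -- Contexts C with a hole in Γ′ ∣ Δ′ and the whole in Γ ∣ Δ, typed
  -- uniformly in the type of the hole: if the hole has computation type A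
  -- then so has the whole.  This is what makes both C[N₁] : ▷ τ and
  -- C[let val x = N₁ in N₂] : A well formed for arbitrary A.  A hole in an
  -- argument of a function symbol, or bound by a let, has a type (and the
  -- whole its own type) fixed by the rest of the context, so it can only be
  -- in the body of a let.
  data Context (Γ′ : VCtx) (Δ′ : CCtx) : VCtx → CCtx → Set s where
    hole      : Context Γ′ Δ′ Γ′ Δ′
    letval-in : Γ ∣ Δ ⊢ᶜ ▷ τ → Context Γ′ Δ′ (τ ∷ Γ) nothing → Context Γ′ Δ′ Γ Δ

  plug : Context Γ′ Δ′ Γ Δ → Γ′ ∣ Δ′ ⊢ᶜ A → Γ ∣ Δ ⊢ᶜ A
  plug hole            P = P
  plug (letval-in N C) P = letval N (plug C P)

  bound : Context Γ′ Δ′ Γ Δ → Γ ⊆ Γ′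
  bound hole            i = i
  bound (letval-in N C) i = bound C (there i)

  infix 3 _≐ᵛ_ _≐ᶜ_

  data Equation : Set s where
    _≐ᵛ_ : Γ ⊢ᵛ τ → Γ ⊢ᵛ τ → Equation
    _≐ᶜ_ : Γ ∣ Δ ⊢ᶜ A → Γ ∣ Δ ⊢ᶜ A → Equation

------------------------------------------------------------------------
-- Theories and derivability

record Theory (s a : Level) : Set (lsuc (s ⊔ a)) where
  field
    signature : Signature s
  open Syntax signature public
  field
    Axiom : Equation → Set a

module Derivability {s a : Level} (T : Theory s a) where
  open Theory T

  private variable
    Γ Γ′ : VCtx
    Δ Δ′ : CCtx
    τ τ′ : VTy
    τs   : List VTy
    A A′ B : CTy

  data Derivable : Equation → Set (s ⊔ a) where
    axiom  : ∀ {E} → Axiom E → Derivable E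

    reflᵛ  : {M : Γ ⊢ᵛ τ} → Derivable (M ≐ᵛ M)
    symᵛ   : {M N : Γ ⊢ᵛ τ} → Derivable (M ≐ᵛ N) → Derivable (N ≐ᵛ M)
    transᵛ : {M N P : Γ ⊢ᵛ τ} →
             Derivable (M ≐ᵛ N) → Derivable (N ≐ᵛ P) → Derivable (M ≐ᵛ P)
    reflᶜ  : {M : Γ ∣ Δ ⊢ᶜ A} → Derivable (M ≐ᶜ M)
    symᶜ   : {M N : Γ ∣ Δ ⊢ᶜ A} → Derivable (M ≐ᶜ N) → Derivable (N ≐ᶜ M)
    transᶜ : {M N P : Γ ∣ Δ ⊢ᶜ A} →
             Derivable (M ≐ᶜ N) → Derivable (N ≐ᶜ P) → Derivable (M ≐ᶜ P)

    fun-cong    : {f : Fun (τs ⟶ᵛ τ)} {Ms Ns : All (Γ ⊢ᵛ_) τs} →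
                  (∀ {τ′} (i : τ′ ∈ τs) → Derivable (lookup Ms i ≐ᵛ lookup Ns i)) →
                  Derivable (fun f Ms ≐ᵛ fun f Ns)
    pair-cong   : {M N : Γ ⊢ᵛ τ} {M′ N′ : Γ ⊢ᵛ τ′} →
                  Derivable (M ≐ᵛ N) → Derivable (M′ ≐ᵛ N′) →
                  Derivable (pair M M′ ≐ᵛ pair N N′)
    fst-cong    : {M N : Γ ⊢ᵛ τ `× τ′} →
                  Derivable (M ≐ᵛ N) → Derivable (fst M ≐ᵛ fst N)
    snd-cong    : {M N : Γ ⊢ᵛ τ `× τ′} →
                  Derivable (M ≐ᵛ N) → Derivable (snd M ≐ᵛ snd N)
    cfun-cong   : {g : Fun (τs ⨾ A ⟶ᶜ A′)} {Ms Ns : All (Γ ⊢ᵛ_) τs}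
                  {P Q : Γ ∣ Δ ⊢ᶜ A} →
                  (∀ {τ′} (i : τ′ ∈ τs) → Derivable (lookup Ms i ≐ᵛ lookup Ns i)) →
                  Derivable (P ≐ᶜ Q) →
                  Derivable (cfun g Ms P ≐ᶜ cfun g Ns Q)
    gen-cong    : {h : Fun (τs ⟶ᶜ A)} {Ms Ns : All (Γ ⊢ᵛ_) τs} →
                  (∀ {τ′} (i : τ′ ∈ τs) → Derivable (lookup Ms i ≐ᵛ lookup Ns i)) →
                  Derivable (gen h Ms ≐ᶜ gen h Ns)
    val-cong    : {M N : Γ ⊢ᵛ τ} →
                  Derivable (M ≐ᵛ N) → Derivable (val M ≐ᶜ val N)
    letval-cong : {P Q : Γ ∣ Δ ⊢ᶜ ▷ τ} {P′ Q′ : τ ∷ Γ ∣ nothing ⊢ᶜ A} →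
                  Derivable (P ≐ᶜ Q) → Derivable (P′ ≐ᶜ Q′) →
                  Derivable (letval P P′ ≐ᶜ letval Q Q′)

    subst-vv : {M N : Γ ⊢ᵛ τ} {θ θ′ : Sub Γ Γ′} →
               Derivable (M ≐ᵛ N) →
               (∀ {τ′} (i : τ′ ∈ Γ) → Derivable (θ i ≐ᵛ θ′ i)) →
               Derivable (subᵛ θ M ≐ᵛ subᵛ θ′ N)
    subst-vc : {P Q : Γ ∣ Δ ⊢ᶜ A} {θ θ′ : Sub Γ Γ′} →
               Derivable (P ≐ᶜ Q) →
               (∀ {τ′} (i : τ′ ∈ Γ) → Derivable (θ i ≐ᵛ θ′ i)) →
               Derivable (subᶜ θ P ≐ᶜ subᶜ θ′ Q)
    subst-cc : {P Q : Γ ∣ just A ⊢ᶜ B} {P′ Q′ : Γ ∣ Δ ⊢ᶜ A} →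
               Derivable (P ≐ᶜ Q) → Derivable (P′ ≐ᶜ Q′) →
               Derivable (P [ P′ ]ᶜ ≐ᶜ Q [ Q′ ]ᶜ)

    ×-β₁ : {M : Γ ⊢ᵛ τ} {N : Γ ⊢ᵛ τ′} → Derivable (fst (pair M N) ≐ᵛ M)
    ×-β₂ : {M : Γ ⊢ᵛ τ} {N : Γ ⊢ᵛ τ′} → Derivable (snd (pair M N) ≐ᵛ N)
    ×-η  : {M : Γ ⊢ᵛ τ `× τ′} → Derivable (pair (fst M) (snd M) ≐ᵛ M)
    1-η  : {M : Γ ⊢ᵛ `1} → Derivable (M ≐ᵛ unit)

    let-β : {M : Γ ⊢ᵛ τ} {N : τ ∷ Γ ∣ nothing ⊢ᶜ A} →
            Derivable (letval (val M) N ≐ᶜ N [ M ]ᵛ)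
    let-η : {N : Γ ∣ Δ ⊢ᶜ ▷ τ} →
            Derivable (letval N (val (var (here refl))) ≐ᶜ N)

    -- let val x = C[N₁] in N₂  =  C[let val x = N₁ in N₂].  The variables
    -- bound by C may occur in N₁ but not in N₂, which is weakened past them.
    commute : (C : Context Γ′ Δ′ Γ Δ)
              {N₁ : Γ′ ∣ Δ′ ⊢ᶜ ▷ τ} {N₂ : τ ∷ Γ ∣ nothing ⊢ᶜ A} →
              Derivable (letval (plug C N₁) N₂
                         ≐ᶜ plug C (letval N₁ (renᶜ (lift (bound C)) N₂)))

    -- The commuting conversion for the remaining positions of the hole (the
    -- computation argument of a function symbol, or bound by a let).  Such
    -- contexts are the terms E with a computation variable; here the two
    -- sides have to be E[let val x = N₁ in N₂]  =  let val x = N₁ in E[N₂],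
    -- since  let val x = g(N₁) in N₂ = g(let val x = N₁ in N₂)  fails already
    -- for  g : ▷ σ → ▷ σ  and  ▷  the identity functor on sets.
    commute-arg : (E : Γ ∣ just B ⊢ᶜ A)
                  {N₁ : Γ ∣ Δ ⊢ᶜ ▷ τ} {N₂ : τ ∷ Γ ∣ nothing ⊢ᶜ B} →
                  Derivable (E [ letval N₁ N₂ ]ᶜ
                             ≐ᶜ letval N₁ (renᶜ there E [ N₂ ]ᶜ))

------------------------------------------------------------------------
-- Interpretations

module Semantics
  {s o ℓ e o′ ℓ′ e′ : Level} (S : Signature s)
  {𝒱 : Category o ℓ e} (P : FiniteProducts 𝒱)
  {𝒞 : Category o′ ℓ′ e′} (𝒜 : Action (cartesian P) 𝒞)
  {F : Functor 𝒱 𝒞} (Φ : StrongEquivariant (selfAction (cartesian P)) 𝒜 F)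
  where

  open Syntax S
  open FiniteProducts P
  private
    module 𝒱 = Category 𝒱
    module 𝒞 = Category 𝒞
  open Action 𝒜
  open Functor F using (F₀; F₁)
  open StrongEquivariant Φ using (φ; φ⁻¹)

  record BaseInterpretation : Set (s ⊔ o ⊔ o′) where
    field
      ⟦_⟧ᵇᵛ : BaseV → 𝒱.Obj
      ⟦_⟧ᵇᶜ : BaseC → 𝒞.Obj

    ⟦_⟧ᵗ : VTy → 𝒱.Obj
    ⟦ base b ⟧ᵗ   = ⟦ b ⟧ᵇᵛ
    ⟦ τ `× τ′ ⟧ᵗ = ⟦ τ ⟧ᵗ ⊠ ⟦ τ′ ⟧ᵗ
    ⟦ `1 ⟧ᵗ       = 𝟙

    ⟦_⟧ᵀ : CTy → 𝒞.Obj
    ⟦ base b ⟧ᵀ = ⟦ b ⟧ᵇᶜ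
    ⟦ ▷ τ ⟧ᵀ    = F₀ ⟦ τ ⟧ᵗ

    -- The head of the list is the last factor, so that ⟦ x : τ , Γ ⟧ is
    -- literally ⟦ Γ ⟧ × ⟦ τ ⟧.
    ⟦_⟧* : List VTy → 𝒱.Obj
    ⟦ [] ⟧*     = 𝟙
    ⟦ τ ∷ τs ⟧* = ⟦ τs ⟧* ⊠ ⟦ τ ⟧ᵗ

    ⟦_∣_⟧ : VCtx → CCtx → 𝒞.Obj
    ⟦ Γ ∣ nothing ⟧ = F₀ ⟦ Γ ⟧*
    ⟦ Γ ∣ just A ⟧  = ⟦ Γ ⟧* ·₀ ⟦ A ⟧ᵀ

  record Interpretation : Set (s ⊔ o ⊔ ℓ ⊔ o′ ⊔ ℓ′) where
    field
      baseInterpretation : BaseInterpretation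

    open BaseInterpretation baseInterpretation public

    field
      ⟦fun⟧  : ∀ {τs τ} → Fun (τs ⟶ᵛ τ) → ⟦ τs ⟧* 𝒱.⇒ ⟦ τ ⟧ᵗ
      ⟦cfun⟧ : ∀ {τs A A′} → Fun (τs ⨾ A ⟶ᶜ A′) → ⟦ τs ⟧* ·₀ ⟦ A ⟧ᵀ 𝒞.⇒ ⟦ A′ ⟧ᵀ
      ⟦gen⟧  : ∀ {τs A} → Fun (τs ⟶ᶜ A) → F₀ ⟦ τs ⟧* 𝒞.⇒ ⟦ A ⟧ᵀ

    d : ∀ Γ Δ → ⟦ Γ ∣ Δ ⟧ 𝒞.⇒ ⟦ Γ ⟧* ·₀ ⟦ Γ ∣ Δ ⟧
    d Γ nothing  = φ⁻¹ ⟦ Γ ⟧* ⟦ Γ ⟧* 𝒞.∘ F₁ δ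
    d Γ (just A) = μ ⟦ Γ ⟧* ⟦ Γ ⟧* ⟦ A ⟧ᵀ 𝒞.∘ (δ ·₁ 𝒞.id)

    ⟦_⟧∈ : ∀ {Γ τ} → τ ∈ Γ → ⟦ Γ ⟧* 𝒱.⇒ ⟦ τ ⟧ᵗ
    ⟦ here refl ⟧∈ = π₂
    ⟦ there i ⟧∈   = ⟦ i ⟧∈ 𝒱.∘ π₁

    mutual
      ⟦_⟧ᵛ : ∀ {Γ τ} → Γ ⊢ᵛ τ → ⟦ Γ ⟧* 𝒱.⇒ ⟦ τ ⟧ᵗ
      ⟦ var i ⟧ᵛ    = ⟦ i ⟧∈
      ⟦ fun f Ms ⟧ᵛ = ⟦fun⟧ f 𝒱.∘ ⟦ Ms ⟧ᵛ*
      ⟦ pair M N ⟧ᵛ = ⟨ ⟦ M ⟧ᵛ , ⟦ N ⟧ᵛ ⟩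
      ⟦ fst M ⟧ᵛ    = π₁ 𝒱.∘ ⟦ M ⟧ᵛ
      ⟦ snd M ⟧ᵛ    = π₂ 𝒱.∘ ⟦ M ⟧ᵛ
      ⟦ unit ⟧ᵛ     = !

      ⟦_⟧ᵛ* : ∀ {Γ τs} → All (Γ ⊢ᵛ_) τs → ⟦ Γ ⟧* 𝒱.⇒ ⟦ τs ⟧*
      ⟦ [] ⟧ᵛ*     = !
      ⟦ M ∷ Ms ⟧ᵛ* = ⟨ ⟦ Ms ⟧ᵛ* , ⟦ M ⟧ᵛ ⟩

    ⟦_⟧ᶜ : ∀ {Γ Δ A} → Γ ∣ Δ ⊢ᶜ A → ⟦ Γ ∣ Δ ⟧ 𝒞.⇒ ⟦ A ⟧ᵀ
    ⟦_⟧ᶜ {Γ} {Δ} {A} cvar    = η ⟦ A ⟧ᵀ 𝒞.∘ (! ·₁ 𝒞.id)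
    ⟦_⟧ᶜ {Γ} {Δ} (cfun g Ms N) =
      ⟦cfun⟧ g 𝒞.∘ ((⟦ Ms ⟧ᵛ* ·₁ ⟦ N ⟧ᶜ) 𝒞.∘ d Γ Δ)
    ⟦ gen h Ms ⟧ᶜ            = ⟦gen⟧ h 𝒞.∘ F₁ ⟦ Ms ⟧ᵛ*
    ⟦ val M ⟧ᶜ               = F₁ ⟦ M ⟧ᵛ
    ⟦_⟧ᶜ {Γ} {Δ} (letval {τ = τ} N₁ N₂) =
      ⟦ N₂ ⟧ᶜ 𝒞.∘ (φ ⟦ Γ ⟧* ⟦ τ ⟧ᵗ 𝒞.∘ ((𝒱.id ·₁ ⟦ N₁ ⟧ᶜ) 𝒞.∘ d Γ Δ))

    data Satisfied : Equation → Set (s ⊔ e ⊔ e′) where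
      sat-v : ∀ {Γ τ} {M N : Γ ⊢ᵛ τ} → ⟦ M ⟧ᵛ 𝒱.≈ ⟦ N ⟧ᵛ → Satisfied (M ≐ᵛ N)
      sat-c : ∀ {Γ Δ A} {M N : Γ ∣ Δ ⊢ᶜ A} → ⟦ M ⟧ᶜ 𝒞.≈ ⟦ N ⟧ᶜ → Satisfied (M ≐ᶜ N)

{-# OPTIONS --safe #-}

-- For a fixed computation context Δ the functor m ↦ ⟦ m ∣ Δ ⟧ (either F or
-- the free one, m ↦ m · ⟦ A ⟧) is itself strong equivariant, with d as the
-- coaction of the comonoid m.  The terms over Γ thus compose as in the
-- coKleisli category of ⟦ Γ ⟧ · -, by  k ⋆ n = k ∘ (id · n) ∘ d,  and let val,
-- the application of a function symbol to a computation, and substitution of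
-- a computation are all instances of ⋆.  The equations of the calculus are
-- then the unit law, the associativity and the base change of ⋆, and its
-- compatibility with φ.
module Submission where

open import Defs
open import Level using (Level)
open import Data.List.Base using ([]; _∷_)
open import Data.List.Membership.Propositional using (_∈_)
open import Data.List.Relation.Binary.Subset.Propositional using (_⊆_)
open import Data.List.Relation.Unary.All using (All; []; _∷_; lookup)
open import Data.List.Relation.Unary.Any using (here; there)
open import Data.Maybe.Base using (just; nothing)
open import Data.Product.Base using (Σ; _,_)
open import Relation.Binary.PropositionalEquality.Core using (refl)
import Relation.Binary.Reasoning.Setoid as SetoidReasoning

-- Rewriting with composites and isomorphisms.

module CategoryLemmas {o ℓ e : Level} (C : Category o ℓ e) where
  open Category C

  module HomReasoning {A B : Obj} = SetoidReasoning (homSetoid A B)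

  private variable
    W X Y Z Y′ : Obj

  infixr 5 _⊙_
  _⊙_ : {f g h : X ⇒ Y} → f ≈ g → g ≈ h → f ≈ h
  _⊙_ = Equiv.trans

  pullˡ : {f : Y ⇒ Z} {g : X ⇒ Y} {h : X ⇒ Z} {k : W ⇒ X} →
          f ∘ g ≈ h → f ∘ (g ∘ k) ≈ h ∘ k
  pullˡ p = Equiv.sym assoc ⊙ ∘-resp-≈ˡ p

  extendʳ : {f : Y ⇒ Z} {g : X ⇒ Y} {h : Y′ ⇒ Z} {i : X ⇒ Y′} {k : W ⇒ X} →
            f ∘ g ≈ h ∘ i → f ∘ (g ∘ k) ≈ h ∘ (i ∘ k)
  extendʳ p = pullˡ p ⊙ assoc

  cancelˡ : {f : Y ⇒ X} {g : X ⇒ Y} {k : W ⇒ X} → f ∘ g ≈ id → f ∘ (g ∘ k) ≈ k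
  cancelˡ p = pullˡ p ⊙ identityˡ

  inverse : Iso X Y → Iso Y X
  inverse i = record { from = to ; to = from ; isoˡ = isoʳ ; isoʳ = isoˡ }
    where open Iso i

  iso-epi : (i : Iso X Y) {f g : Y ⇒ Z} → f ∘ Iso.from i ≈ g ∘ Iso.from i → f ≈ g
  iso-epi i {f} {g} p = Equiv.sym (undo f) ⊙ ∘-resp-≈ˡ p ⊙ undo g
    where
    undo : (h : _ ⇒ _) → (h ∘ Iso.from i) ∘ Iso.to i ≈ h
    undo h = assoc ⊙ ∘-resp-≈ʳ (Iso.isoʳ i) ⊙ identityʳ

  iso-moveʳ : (i : Iso X Y) {f : X ⇒ Z} {g : Y ⇒ Z} →
              f ≈ g ∘ Iso.from i → f ∘ Iso.to i ≈ g
  iso-moveʳ i p = ∘-resp-≈ˡ p ⊙ assoc ⊙ ∘-resp-≈ʳ (Iso.isoʳ i) ⊙ identityʳ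

  iso-moveˡ : (i : Iso Y Z) {f : X ⇒ Y} {g : X ⇒ Z} →
              Iso.from i ∘ f ≈ g → f ≈ Iso.to i ∘ g
  iso-moveˡ i p = Equiv.sym (cancelˡ (Iso.isoˡ i)) ⊙ ∘-resp-≈ʳ p

  -- Turns a naturality square for a family of isomorphisms into the one for their inverses. It is
  -- applied to `φ`, and to `μ`, whose inverse is the structure map of the free functors.
  conjugate : (i : Iso X Y) (j : Iso W Z) {f : Y ⇒ Z} {g : X ⇒ W} →
              f ∘ Iso.from i ≈ Iso.from j ∘ g → g ∘ Iso.to i ≈ Iso.to j ∘ f
  conjugate i j p = iso-moveʳ i (iso-moveˡ j (Equiv.sym p) ⊙ Equiv.sym assoc)

-- Finite products and the diagonal.

module ProductLemmas {o ℓ e : Level} {𝒱 : Category o ℓ e} (P : FiniteProducts 𝒱) where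
  open Category 𝒱
  open FiniteProducts P
  open CategoryLemmas 𝒱

  private variable
    A B C D A′ B′ : Obj

  !-unique₂ : {f g : A ⇒ 𝟙} → f ≈ g
  !-unique₂ {f = f} {g} = !-unique f ⊙ Equiv.sym (!-unique g)

  ⟨⟩-cong : {f f′ : C ⇒ A} {g g′ : C ⇒ B} → f ≈ f′ → g ≈ g′ → ⟨ f , g ⟩ ≈ ⟨ f′ , g′ ⟩
  ⟨⟩-cong p q = unique (project₁ ⊙ p) (project₂ ⊙ q)

  ⟨⟩∘ : {f : C ⇒ A} {g : C ⇒ B} {h : D ⇒ C} → ⟨ f , g ⟩ ∘ h ≈ ⟨ f ∘ h , g ∘ h ⟩
  ⟨⟩∘ = unique (pullˡ project₁) (pullˡ project₂)

  ⊠₁∘⟨⟩ : {f : A ⇒ A′} {g : B ⇒ B′} {h : C ⇒ A} {k : C ⇒ B} →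
          (f ⊠₁ g) ∘ ⟨ h , k ⟩ ≈ ⟨ f ∘ h , g ∘ k ⟩
  ⊠₁∘⟨⟩ = ⟨⟩∘ ⊙ ⟨⟩-cong (assoc ⊙ ∘-resp-≈ʳ project₁) (assoc ⊙ ∘-resp-≈ʳ project₂)

  ⊠₁∘δ : {f : C ⇒ A} {g : C ⇒ B} → (f ⊠₁ g) ∘ δ ≈ ⟨ f , g ⟩
  ⊠₁∘δ = ⊠₁∘⟨⟩ ⊙ ⟨⟩-cong identityʳ identityʳ

  δ-natural : {f : A ⇒ B} → δ ∘ f ≈ (f ⊠₁ f) ∘ δ
  δ-natural = ⟨⟩∘ ⊙ ⟨⟩-cong identityˡ identityˡ ⊙ Equiv.sym ⊠₁∘δ

  α⇒ : ∀ A B C → (A ⊠ B) ⊠ C ⇒ A ⊠ (B ⊠ C)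
  α⇒ = Monoidal.α⇒ (cartesian P)

  -- In elements both sides send (x , y) to (x , (x , y)). So copying the first factor alone amounts
  -- to copying the whole pair and dropping y from the first copy, which is how a context enlarged
  -- by a bound variable enters.
  α∘δ⊠id : α⇒ A A B ∘ (δ ⊠₁ id) ≈ (π₁ ⊠₁ id) ∘ δ
  α∘δ⊠id = Equiv.trans ⟨⟩∘ (⟨⟩-cong
      (assoc ⊙ ∘-resp-≈ʳ project₁ ⊙ cancelˡ project₁)
      (⟨⟩∘ ⊙ ⟨⟩-cong (assoc ⊙ ∘-resp-≈ʳ project₁ ⊙ cancelˡ project₂)
                      (project₂ ⊙ identityˡ)
           ⊙ Equiv.sym (unique identityʳ identityʳ)))
    ⊙ Equiv.sym ⊠₁∘δ

-- Actegories over a cartesian category, and free equivariant functors.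

module ActionLemmas
  {o ℓ e o′ ℓ′ e′ : Level} {𝒱 : Category o ℓ e} (P : FiniteProducts 𝒱)
  {𝒞 : Category o′ ℓ′ e′} (𝒜 : Action (cartesian P) 𝒞)
  where

  private
    module 𝒱 = Category 𝒱
    module × = ProductLemmas P
    module ⊗ = Monoidal (cartesian P)
  open FiniteProducts P
  open Category 𝒞
  open CategoryLemmas 𝒞
  open Action 𝒜
  open HomReasoning

  private variable
    m m′ m″ n n′ : 𝒱.Obj
    a b c c′ c″ : Obj

  ·-∘ : {f : m′ 𝒱.⇒ m″} {f′ : m 𝒱.⇒ m′} {g : c′ ⇒ c″} {g′ : c ⇒ c′} →
        (f ·₁ g) ∘ (f′ ·₁ g′) ≈ (f 𝒱.∘ f′) ·₁ (g ∘ g′)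
  ·-∘ = Equiv.sym (Functor.homomorphism act)

  ·-cong : {f f′ : m 𝒱.⇒ m′} {g g′ : c ⇒ c′} → f 𝒱.≈ f′ → g ≈ g′ → f ·₁ g ≈ f′ ·₁ g′
  ·-cong p q = Functor.F-resp-≈ act (p , q)

  ·-id : 𝒱.id {m} ·₁ id {c} ≈ id
  ·-id = Functor.identity act

  ·-∘ʳ : {g : c′ ⇒ c″} {g′ : c ⇒ c′} →
         (𝒱.id {m} ·₁ g) ∘ (𝒱.id ·₁ g′) ≈ 𝒱.id ·₁ (g ∘ g′)
  ·-∘ʳ = ·-∘ ⊙ ·-cong 𝒱.identityˡ Equiv.refl

  ·-∘ˡ : {f : m′ 𝒱.⇒ m″} {f′ : m 𝒱.⇒ m′} →
         (f ·₁ id {c}) ∘ (f′ ·₁ id) ≈ (f 𝒱.∘ f′) ·₁ id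
  ·-∘ˡ = ·-∘ ⊙ ·-cong 𝒱.Equiv.refl identityˡ

  ·-split₁₂ : {f : m 𝒱.⇒ m′} {g : c ⇒ c′} → (f ·₁ id) ∘ (𝒱.id ·₁ g) ≈ f ·₁ g
  ·-split₁₂ = ·-∘ ⊙ ·-cong 𝒱.identityʳ identityˡ

  ·-split₂₁ : {f : m 𝒱.⇒ m′} {g : c ⇒ c′} → (𝒱.id ·₁ g) ∘ (f ·₁ id) ≈ f ·₁ g
  ·-split₂₁ = ·-∘ ⊙ ·-cong 𝒱.identityˡ identityʳ

  ·-swap : {f : m 𝒱.⇒ m′} {g : c ⇒ c′} →
           (f ·₁ id) ∘ (𝒱.id ·₁ g) ≈ (𝒱.id ·₁ g) ∘ (f ·₁ id)
  ·-swap = ·-split₁₂ ⊙ Equiv.sym ·-split₂₁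

  ·-isoʳ : Iso c c′ → Iso (m ·₀ c) (m ·₀ c′)
  ·-isoʳ i = record
    { from = 𝒱.id ·₁ from
    ; to   = 𝒱.id ·₁ to
    ; isoˡ = ·-∘ʳ ⊙ ·-cong 𝒱.Equiv.refl isoˡ ⊙ ·-id
    ; isoʳ = ·-∘ʳ ⊙ ·-cong 𝒱.Equiv.refl isoʳ ⊙ ·-id
    }
    where open Iso i

  ·-isoˡ : 𝒱.Iso m m′ → Iso (m ·₀ c) (m′ ·₀ c)
  ·-isoˡ i = record
    { from = from ·₁ id
    ; to   = to ·₁ id
    ; isoˡ = ·-∘ˡ ⊙ ·-cong isoˡ Equiv.refl ⊙ ·-id
    ; isoʳ = ·-∘ˡ ⊙ ·-cong isoʳ Equiv.refl ⊙ ·-id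
    }
    where open 𝒱.Iso i

  -- `η` is a natural isomorphism from 𝟙 · - to the identity functor, which is faithful.
  𝟙·-faithful : {f g : c ⇒ c′} → 𝒱.id {𝟙} ·₁ f ≈ 𝒱.id ·₁ g → f ≈ g
  𝟙·-faithful p =
    iso-epi (unitIso _) (η-natural _ ⊙ ∘-resp-≈ʳ p ⊙ Equiv.sym (η-natural _))

  -- Kelly's argument: both sides agree after 𝟙 · - and precomposition with
  -- an isomorphism out of ((𝟙 ⊠ 𝟙) ⊠ m) · c.
  unitˡ-coh : ∀ m c → η (m ·₀ c) ∘ μ 𝟙 m c ≈ π₂ ·₁ id
  unitˡ-coh m c = 𝟙·-faithful (iso-epi (multIso 𝟙 (𝟙 ⊠ m) c)
    (iso-epi (·-isoˡ (⊗.associator 𝟙 𝟙 m)) (begin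
      ((𝒱.id ·₁ (η (m ·₀ c) ∘ μ 𝟙 m c)) ∘ μ 𝟙 (𝟙 ⊠ m) c) ∘ (⊗.α⇒ 𝟙 𝟙 m ·₁ id)
        ≈⟨ assoc ⊙ ∘-resp-≈ˡ (Equiv.sym ·-∘ʳ) ⊙ assoc ⟩
      (𝒱.id ·₁ η (m ·₀ c)) ∘
        ((𝒱.id ·₁ μ 𝟙 m c) ∘ (μ 𝟙 (𝟙 ⊠ m) c ∘ (⊗.α⇒ 𝟙 𝟙 m ·₁ id)))
        ≈⟨ ∘-resp-≈ʳ (Equiv.sym (assoc-coh 𝟙 𝟙 m c)) ⟩
      (𝒱.id ·₁ η (m ·₀ c)) ∘ (μ 𝟙 𝟙 (m ·₀ c) ∘ μ (𝟙 ⊠ 𝟙) m c)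
        ≈⟨ pullˡ (unit-coh 𝟙 (m ·₀ c)) ⟩
      (⊗.ρ⇒ 𝟙 ·₁ id) ∘ μ (𝟙 ⊠ 𝟙) m c
        ≈⟨ ∘-resp-≈ˡ (·-cong 𝒱.Equiv.refl (Equiv.sym ·-id)) ⟩
      (⊗.ρ⇒ 𝟙 ·₁ (𝒱.id ·₁ id)) ∘ μ (𝟙 ⊠ 𝟙) m c
        ≈⟨ μ-natural (⊗.ρ⇒ 𝟙) 𝒱.id id ⟩
      μ 𝟙 m c ∘ ((⊗.ρ⇒ 𝟙 ⊠₁ 𝒱.id) ·₁ id)
        ≈⟨ ∘-resp-≈ʳ (·-cong (𝒱.Equiv.sym (⊗.triangle 𝟙 m)) Equiv.refl ⊙ Equiv.sym ·-∘ˡ) ⟩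
      μ 𝟙 m c ∘ (((𝒱.id ⊠₁ π₂) ·₁ id) ∘ (⊗.α⇒ 𝟙 𝟙 m ·₁ id))
        ≈⟨ extendʳ (Equiv.sym (μ-natural 𝒱.id π₂ id)) ⟩
      (𝒱.id ·₁ (π₂ ·₁ id)) ∘ (μ 𝟙 (𝟙 ⊠ m) c ∘ (⊗.α⇒ 𝟙 𝟙 m ·₁ id))
        ≈⟨ Equiv.sym assoc ⟩
      ((𝒱.id ·₁ (π₂ ·₁ id)) ∘ μ 𝟙 (𝟙 ⊠ m) c) ∘ (⊗.α⇒ 𝟙 𝟙 m ·₁ id) ∎)))

  Equivariant : Functor 𝒱 𝒞 → Set _
  Equivariant G = StrongEquivariant (selfAction (cartesian P)) 𝒜 G

  free : Obj → Functor 𝒱 𝒞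
  free c = record
    { F₀           = _·₀ c
    ; F₁           = _·₁ id
    ; identity     = ·-id
    ; homomorphism = Equiv.sym ·-∘ˡ
    ; F-resp-≈     = λ p → ·-cong p Equiv.refl
    }

  -- The structure map is the inverse of `μ`, so `φ-mult` is `assoc-coh` with two isomorphisms moved
  -- across, and `φ-unit` is the left unit coherence derived above. As `φ⁻¹` is then `μ` by
  -- computation, the coaction below unfolds to the clause of `d` for a nonempty computation
  -- context.
  free-equivariant : ∀ c → Equivariant (free c)
  free-equivariant c = record
    { φ-iso     = λ m n → inverse (multIso m n c)
    ; φ-natural = λ f g → conjugate (multIso _ _ _) (multIso _ _ _) (μ-natural f g id)
    ; φ-mult    = λ m n k →
        iso-moveˡ (multIso m (n ⊠ k) c)
          (Equiv.sym assoc ⊙ iso-moveʳ (multIso (m ⊠ n) k c)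
            (iso-moveˡ (·-isoʳ (multIso n k c)) (Equiv.sym (assoc-coh m n k c))
              ⊙ Equiv.sym assoc))
    ; φ-unit    = λ m → iso-moveʳ (multIso 𝟙 m c) (Equiv.sym (unitˡ-coh m c))
    }

  -- The counit of the comonad m · -, which discards the context. It is also, literally, the
  -- interpretation of a computation variable.
  ε : m ·₀ c ⇒ c
  ε = η _ ∘ (! ·₁ id)

  ε-natural : {f : c ⇒ c′} → ε {m} ∘ (𝒱.id ·₁ f) ≈ f ∘ ε
  ε-natural = assoc ⊙ ∘-resp-≈ʳ ·-swap ⊙ extendʳ (Equiv.sym (η-natural _))

  -- The coaction on an equivariant functor and coKleisli composition.

  module Coaction {G : Functor 𝒱 𝒞} (Ψ : Equivariant G) where
    open Functor G renaming (F₀ to G₀; F₁ to G₁)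
    open StrongEquivariant Ψ

    coaction : G₀ m ⇒ m ·₀ G₀ m
    coaction = φ⁻¹ _ _ ∘ G₁ δ

    infixl 8 _⋆_
    _⋆_ : m ·₀ c ⇒ a → G₀ m ⇒ c → G₀ m ⇒ a
    k ⋆ n = k ∘ ((𝒱.id ·₁ n) ∘ coaction)

    φ⁻¹-natural : (f : m 𝒱.⇒ m′) (g : n 𝒱.⇒ n′) →
                  (f ·₁ G₁ g) ∘ φ⁻¹ m n ≈ φ⁻¹ m′ n′ ∘ G₁ (f ⊠₁ g)
    φ⁻¹-natural f g = conjugate (φ-iso _ _) (φ-iso _ _) (φ-natural f g)

    φ-naturalˡ : (f : m 𝒱.⇒ m′) → G₁ (f ⊠₁ 𝒱.id {n}) ∘ φ m n ≈ φ m′ n ∘ (f ·₁ id)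
    φ-naturalˡ f = φ-natural f 𝒱.id ⊙ ∘-resp-≈ʳ (·-cong 𝒱.Equiv.refl identity)

    φ⁻¹-naturalˡ : (f : m 𝒱.⇒ m′) → (f ·₁ id) ∘ φ⁻¹ m n ≈ φ⁻¹ m′ n ∘ G₁ (f ⊠₁ 𝒱.id)
    φ⁻¹-naturalˡ f = ∘-resp-≈ˡ (·-cong 𝒱.Equiv.refl (Equiv.sym identity)) ⊙ φ⁻¹-natural f 𝒱.id

    coaction-natural : (f : m 𝒱.⇒ m′) → coaction ∘ G₁ f ≈ (f ·₁ G₁ f) ∘ coaction
    coaction-natural f = begin
      (φ⁻¹ _ _ ∘ G₁ δ) ∘ G₁ f           ≈⟨ assoc ⊙ ∘-resp-≈ʳ (Equiv.sym homomorphism) ⟩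
      φ⁻¹ _ _ ∘ G₁ (δ 𝒱.∘ f)            ≈⟨ ∘-resp-≈ʳ (F-resp-≈ ×.δ-natural ⊙ homomorphism) ⟩
      φ⁻¹ _ _ ∘ (G₁ (f ⊠₁ f) ∘ G₁ δ)    ≈⟨ extendʳ (Equiv.sym (φ⁻¹-natural f f)) ⟩
      (f ·₁ G₁ f) ∘ (φ⁻¹ _ _ ∘ G₁ δ)    ∎

    -- `φ-unit` speaks of 𝟙 only. A general m reduces to it because `π₂` factors through `! ⊠₁ id`,
    -- and naturality of `φ` moves `!` to the other side. For F this says that the body `val x` of a
    -- let acts as the counit, which gives the η-law.
    π₂-φ : G₁ π₂ ∘ φ m n ≈ ε
    π₂-φ {m} {n} = begin
      G₁ π₂ ∘ φ m n
        ≈⟨ ∘-resp-≈ˡ (F-resp-≈ (𝒱.Equiv.sym (𝒱.Equiv.trans project₂ 𝒱.identityˡ))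
                       ⊙ homomorphism) ⟩
      (G₁ π₂ ∘ G₁ (! ⊠₁ 𝒱.id)) ∘ φ m n    ≈⟨ assoc ⊙ ∘-resp-≈ʳ (φ-naturalˡ !) ⟩
      G₁ π₂ ∘ (φ 𝟙 n ∘ (! ·₁ id))         ≈⟨ pullˡ (φ-unit n) ⟩
      ε ∎

    coaction-counit : ε ∘ coaction {m} ≈ id
    coaction-counit = begin
      ε ∘ coaction                          ≈⟨ ∘-resp-≈ˡ (Equiv.sym π₂-φ) ⊙ assoc ⟩
      G₁ π₂ ∘ (φ _ _ ∘ (φ⁻¹ _ _ ∘ G₁ δ))    ≈⟨ ∘-resp-≈ʳ (cancelˡ (Iso.isoʳ (φ-iso _ _))) ⟩
      G₁ π₂ ∘ G₁ δ                          ≈⟨ Equiv.sym homomorphism ⟩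
      G₁ (π₂ 𝒱.∘ δ)                         ≈⟨ F-resp-≈ project₂ ⊙ identity ⟩
      id                                    ∎

    ⋆-identityˡ : {n : G₀ m ⇒ c} → ε ⋆ n ≈ n
    ⋆-identityˡ = pullˡ ε-natural ⊙ assoc ⊙ ∘-resp-≈ʳ coaction-counit ⊙ identityʳ

    -- The coaction inherits naturality from the diagonal, so f gets duplicated: one copy reindexes
    -- k, the other n.
    ⋆-reindex : {k : m ·₀ c ⇒ a} {n : G₀ m ⇒ c} (f : m′ 𝒱.⇒ m) →
                (k ⋆ n) ∘ G₁ f ≈ (k ∘ (f ·₁ id)) ⋆ (n ∘ G₁ f)
    ⋆-reindex {k = k} {n} f = begin
      (k ∘ ((𝒱.id ·₁ n) ∘ coaction)) ∘ G₁ f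
        ≈⟨ assoc ⊙ ∘-resp-≈ʳ (assoc ⊙ ∘-resp-≈ʳ (coaction-natural f)) ⟩
      k ∘ ((𝒱.id ·₁ n) ∘ ((f ·₁ G₁ f) ∘ coaction))
        ≈⟨ ∘-resp-≈ʳ (pullˡ (·-∘ ⊙ ·-cong 𝒱.identityˡ Equiv.refl ⊙ Equiv.sym ·-split₁₂) ⊙ assoc) ⟩
      k ∘ ((f ·₁ id) ∘ ((𝒱.id ·₁ (n ∘ G₁ f)) ∘ coaction))
        ≈⟨ Equiv.sym assoc ⟩
      (k ∘ (f ·₁ id)) ⋆ (n ∘ G₁ f) ∎

    ⋆-cong : {k k′ : m ·₀ c ⇒ a} {n n′ : G₀ m ⇒ c} → k ≈ k′ → n ≈ n′ → k ⋆ n ≈ k′ ⋆ n′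
    ⋆-cong p q = ∘-resp-≈ p (∘-resp-≈ˡ (·-cong 𝒱.Equiv.refl q))

  open Coaction using (⋆-cong)

  infixl 8 _⋆ᶠ_
  -- Composition in the coKleisli category of m · - itself. It is needed beside `⋆` because the
  -- associativity law composes two operands that both start from an action of m.
  _⋆ᶠ_ : m ·₀ c ⇒ a → m ·₀ b ⇒ c → m ·₀ b ⇒ a
  _⋆ᶠ_ {b = b} = Coaction._⋆_ (free-equivariant b)

  -- A map f that ignores the context slides out through the naturality of `μ` in its last argument.
  ⋆ᶠ-natural : {k : m ·₀ c ⇒ a} {l : m ·₀ b ⇒ c} {f : c′ ⇒ b} →
               k ⋆ᶠ (l ∘ (𝒱.id ·₁ f)) ≈ (k ⋆ᶠ l) ∘ (𝒱.id ·₁ f)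
  ⋆ᶠ-natural {k = k} {l} {f} = begin
    k ∘ ((𝒱.id ·₁ (l ∘ (𝒱.id ·₁ f))) ∘ (μ _ _ _ ∘ (δ ·₁ id)))
      ≈⟨ ∘-resp-≈ʳ (∘-resp-≈ˡ (Equiv.sym ·-∘ʳ) ⊙ assoc ⊙ ∘-resp-≈ʳ (extendʳ (μ-natural _ _ _))) ⟩
    k ∘ ((𝒱.id ·₁ l) ∘ (μ _ _ _ ∘ (((𝒱.id ⊠₁ 𝒱.id) ·₁ f) ∘ (δ ·₁ id))))
      ≈⟨ ∘-resp-≈ʳ (∘-resp-≈ʳ (∘-resp-≈ʳ
           (∘-resp-≈ˡ (·-cong (Functor.identity ⊗.tensor) Equiv.refl) ⊙ Equiv.sym ·-swap))) ⟩
    k ∘ ((𝒱.id ·₁ l) ∘ (μ _ _ _ ∘ ((δ ·₁ id) ∘ (𝒱.id ·₁ f))))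
      ≈⟨ Equiv.sym (assoc ⊙ ∘-resp-≈ʳ (assoc ⊙ ∘-resp-≈ʳ assoc)) ⟩
    (k ⋆ᶠ l) ∘ (𝒱.id ·₁ f) ∎

  -- Compatibility of composition with `φ`, and associativity.

  module CoactionComposition {G : Functor 𝒱 𝒞} (Ψ : Equivariant G) where
    open Functor G renaming (F₀ to G₀; F₁ to G₁)
    open StrongEquivariant Ψ
    open Coaction Ψ hiding (⋆-cong)

    -- `φ` absorbs an argument from G₀ n into the context, enlarging m to m ⊠ n. As k knows only m,
    -- it has to be weakened along `π₁`. This is the semantic content of moving k under the binder
    -- of a let.
    ⋆ᶠ-φ : {k : m ·₀ c ⇒ a} {q : G₀ (m ⊠ n) ⇒ c} →
           k ⋆ᶠ (q ∘ φ m n) ≈ ((k ∘ (π₁ ·₁ id)) ⋆ q) ∘ φ m n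
    ⋆ᶠ-φ {m} {n = n} {k = k} {q} = begin
      k ∘ ((𝒱.id ·₁ (q ∘ φ m n)) ∘ (μ m m (G₀ n) ∘ (δ ·₁ id)))
        ≈⟨ ∘-resp-≈ʳ (∘-resp-≈ˡ (Equiv.sym ·-∘ʳ) ⊙ assoc ⊙ ∘-resp-≈ʳ unfold) ⟩
      k ∘ ((𝒱.id ·₁ q) ∘ ((π₁ ·₁ id) ∘ (coaction ∘ φ m n)))
        ≈⟨ ∘-resp-≈ʳ (extendʳ (Equiv.sym ·-swap)) ⟩
      k ∘ ((π₁ ·₁ id) ∘ ((𝒱.id ·₁ q) ∘ (coaction ∘ φ m n)))
        ≈⟨ Equiv.sym (assoc ⊙ assoc ⊙ ∘-resp-≈ʳ (∘-resp-≈ʳ assoc)) ⟩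
      ((k ∘ (π₁ ·₁ id)) ⋆ q) ∘ φ m n ∎
      where
      unfold : (𝒱.id ·₁ φ m n) ∘ (μ m m (G₀ n) ∘ (δ ·₁ id))
               ≈ (π₁ ·₁ id) ∘ (coaction ∘ φ m n)
      unfold = begin
        (𝒱.id ·₁ φ m n) ∘ (μ m m (G₀ n) ∘ (δ ·₁ id))
          -- `φ-mult` with its outer `φ` inverted trades `μ` for the associator of the product.
          ≈⟨ Equiv.sym assoc ⊙ ∘-resp-≈ˡ (iso-moveˡ (φ-iso _ _) (Equiv.sym (φ-mult m m n))) ⟩
        (φ⁻¹ _ _ ∘ (G₁ (×.α⇒ m m n) ∘ φ (m ⊠ m) n)) ∘ (δ ·₁ id)
          ≈⟨ assoc ⊙ ∘-resp-≈ʳ (assoc ⊙ ∘-resp-≈ʳ (Equiv.sym (φ-naturalˡ δ))) ⟩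
        φ⁻¹ _ _ ∘ (G₁ (×.α⇒ m m n) ∘ (G₁ (δ ⊠₁ 𝒱.id) ∘ φ m n))
          -- The copy of m becomes a copy of m ⊠ n with n projected away, so that the coaction at m
          -- ⊠ n appears.
          ≈⟨ ∘-resp-≈ʳ (pullˡ (Equiv.sym homomorphism ⊙ F-resp-≈ ×.α∘δ⊠id ⊙ homomorphism)) ⟩
        φ⁻¹ _ _ ∘ ((G₁ (π₁ ⊠₁ 𝒱.id) ∘ G₁ δ) ∘ φ m n)
          ≈⟨ ∘-resp-≈ʳ assoc ⊙ extendʳ (Equiv.sym (φ⁻¹-naturalˡ π₁)) ⟩
        (π₁ ·₁ id) ∘ (φ⁻¹ _ _ ∘ (G₁ δ ∘ φ m n))
          ≈⟨ ∘-resp-≈ʳ (Equiv.sym assoc) ⟩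
        (π₁ ·₁ id) ∘ (coaction ∘ φ m n) ∎

    -- With l ⋆ n = q ∘ G₁ δ this reduces to the compatibility of ⋆ with φ.
    ⋆-assoc : {k : m ·₀ c ⇒ a} {l : m ·₀ b ⇒ c} {n : G₀ m ⇒ b} →
              k ⋆ (l ⋆ n) ≈ (k ⋆ᶠ l) ⋆ n
    ⋆-assoc {m} {k = k} {l} {n} = begin
      k ⋆ (l ⋆ n)
        ≈⟨ ⋆-cong Ψ k-split (∘-resp-≈ʳ (Equiv.sym assoc) ⊙ Equiv.sym assoc) ⟩
      ((k ∘ (π₁ ·₁ id)) ∘ (δ ·₁ id)) ⋆ (q ∘ G₁ δ)
        ≈⟨ Equiv.sym (⋆-reindex δ) ⟩
      ((k ∘ (π₁ ·₁ id)) ⋆ q) ∘ G₁ δ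
        ≈⟨ Equiv.sym (∘-resp-≈ʳ (cancelˡ (Iso.isoʳ (φ-iso m m)))) ⟩
      ((k ∘ (π₁ ·₁ id)) ⋆ q) ∘ (φ m m ∘ coaction)
        ≈⟨ pullˡ (Equiv.sym ⋆ᶠ-φ) ⟩
      (k ⋆ᶠ (q ∘ φ m m)) ∘ coaction
        ≈⟨ ∘-resp-≈ˡ (⋆-cong (free-equivariant _) Equiv.refl q∘φ ⊙ ⋆ᶠ-natural) ⊙ assoc ⟩
      (k ⋆ᶠ l) ⋆ n ∎
      where
      q : G₀ (m ⊠ m) ⇒ _
      q = l ∘ ((𝒱.id ·₁ n) ∘ φ⁻¹ m m)

      q∘φ : q ∘ φ m m ≈ l ∘ (𝒱.id ·₁ n)
      q∘φ = assoc ⊙ ∘-resp-≈ʳ (assoc ⊙ ∘-resp-≈ʳ (Iso.isoˡ (φ-iso m m)) ⊙ identityʳ)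

      k-split : k ≈ (k ∘ (π₁ ·₁ id)) ∘ (δ ·₁ id)
      k-split = Equiv.sym (assoc
        ⊙ ∘-resp-≈ʳ (·-∘ˡ ⊙ ·-cong project₁ Equiv.refl ⊙ ·-id) ⊙ identityʳ)

-- The interpretation in terms of `⋆`; renaming and substitution as reindexing.

module Soundness
  {s o ℓ e o′ ℓ′ e′ : Level} (S : Signature s)
  {𝒱 : Category o ℓ e} (P : FiniteProducts 𝒱)
  {𝒞 : Category o′ ℓ′ e′} (𝒜 : Action (cartesian P) 𝒞)
  {F : Functor 𝒱 𝒞} (Φ : StrongEquivariant (selfAction (cartesian P)) 𝒜 F)
  (I : Semantics.Interpretation S P 𝒜 Φ)
  where

  open Syntax S
  open Semantics S P 𝒜 Φ using (module Interpretation)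
  open Interpretation I
  open FiniteProducts P
  open Functor F using (F₀; F₁)
  open StrongEquivariant Φ using (φ; φ⁻¹; φ-iso)
  open Action 𝒜
  open ActionLemmas P 𝒜
  open ProductLemmas P using (⟨⟩-cong; ⟨⟩∘; ⊠₁∘⟨⟩; ⊠₁∘δ; !-unique₂)
  private
    module 𝒱 where
      open Category 𝒱 public
      open CategoryLemmas 𝒱 public
    module F where
      open Functor F public
      open Coaction Φ public
      open CoactionComposition Φ public
    module Free (c : Category.Obj 𝒞) where
      open Functor (free c) public
      open Coaction (free-equivariant c) public
      open CoactionComposition (free-equivariant c) public
  open Category 𝒞
  open CategoryLemmas 𝒞
  open HomReasoning

  private variable
    Γ Γ′    : VCtx
    Δ Δ′    : CCtx
    σ τ     : VTy
    τs      : VCtx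
    A B     : CTy
    a b c   : Obj

  reindex : ∀ Γ′ Γ Δ → ⟦ Γ′ ⟧* 𝒱.⇒ ⟦ Γ ⟧* → ⟦ Γ′ ∣ Δ ⟧ ⇒ ⟦ Γ ∣ Δ ⟧
  reindex Γ′ Γ nothing  f = F₁ f
  reindex Γ′ Γ (just A) f = f ·₁ id

  -- A version of `⋆` uniform in Δ. Once Δ is known, `d` computes to the coaction of F or of a free
  -- functor, so each law below follows by a case split from the corresponding law of `⋆`.
  comp : ∀ Γ Δ → ⟦ Γ ⟧* ·₀ c ⇒ a → ⟦ Γ ∣ Δ ⟧ ⇒ c → ⟦ Γ ∣ Δ ⟧ ⇒ a
  comp Γ Δ k n = k ∘ ((𝒱.id ·₁ n) ∘ d Γ Δ)

  infixl 8 comp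
  syntax comp Γ Δ k n = k ⋆[ Γ ∣ Δ ] n

  comp-resp-≈ : ∀ Γ Δ {k k′ : ⟦ Γ ⟧* ·₀ c ⇒ a} {n n′ : ⟦ Γ ∣ Δ ⟧ ⇒ c} →
                k ≈ k′ → n ≈ n′ → k ⋆[ Γ ∣ Δ ] n ≈ k′ ⋆[ Γ ∣ Δ ] n′
  comp-resp-≈ Γ Δ p q = ∘-resp-≈ p (∘-resp-≈ˡ (·-cong 𝒱.Equiv.refl q))

  comp-identityˡ : ∀ Γ Δ {n : ⟦ Γ ∣ Δ ⟧ ⇒ c} → ε ⋆[ Γ ∣ Δ ] n ≈ n
  comp-identityˡ Γ nothing  = F.⋆-identityˡ
  comp-identityˡ Γ (just A) = Free.⋆-identityˡ ⟦ A ⟧ᵀ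

  comp-reindex : ∀ Γ′ Γ Δ {k : ⟦ Γ ⟧* ·₀ c ⇒ a} {n : ⟦ Γ ∣ Δ ⟧ ⇒ c}
                 (f : ⟦ Γ′ ⟧* 𝒱.⇒ ⟦ Γ ⟧*) →
                 (k ⋆[ Γ ∣ Δ ] n) ∘ reindex Γ′ Γ Δ f
                 ≈ (k ∘ (f ·₁ id)) ⋆[ Γ′ ∣ Δ ] (n ∘ reindex Γ′ Γ Δ f)
  comp-reindex Γ′ Γ nothing  = F.⋆-reindex
  comp-reindex Γ′ Γ (just A) = Free.⋆-reindex ⟦ A ⟧ᵀ

  comp-assoc : ∀ Γ Δ {k : ⟦ Γ ⟧* ·₀ c ⇒ a} {l : ⟦ Γ ⟧* ·₀ b ⇒ c} {n : ⟦ Γ ∣ Δ ⟧ ⇒ b} →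
               k ⋆[ Γ ∣ Δ ] (l ⋆[ Γ ∣ Δ ] n) ≈ (k ⋆ᶠ l) ⋆[ Γ ∣ Δ ] n
  comp-assoc Γ nothing  = F.⋆-assoc
  comp-assoc Γ (just A) = Free.⋆-assoc ⟦ A ⟧ᵀ

  -- A relation instead of a chosen interpretation of θ: one morphism can then represent two
  -- substitutions with semantically equal entries, and short forms such as `π₁` for weakening can
  -- replace a tuple of projections.
  record _represents_ {Γ Γ′ : VCtx} (f : ⟦ Γ′ ⟧* 𝒱.⇒ ⟦ Γ ⟧*) (θ : Sub Γ Γ′) :
                      Set (s Level.⊔ e) where
    constructor rep
    field
      at : ∀ {τ} (i : τ ∈ Γ) → ⟦ θ i ⟧ᵛ 𝒱.≈ ⟦ i ⟧∈ 𝒱.∘ f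

  open _represents_

  asSub : Γ ⊆ Γ′ → Sub Γ Γ′
  asSub ρ i = var (ρ i)

  representative : ∀ Γ {Γ′} (θ : Sub Γ Γ′) → Σ (⟦ Γ′ ⟧* 𝒱.⇒ ⟦ Γ ⟧*) (_represents θ)
  representative []      θ = ! , rep λ ()
  representative (τ ∷ Γ) θ with representative Γ (λ i → θ (there i))
  ... | f , r = ⟨ f , ⟦ θ (here refl) ⟧ᵛ ⟩ , rep λ
    { (here refl) → 𝒱.Equiv.sym project₂
    ; (there i)   → at r i 𝒱.⊙ 𝒱.Equiv.sym (𝒱.assoc 𝒱.⊙ 𝒱.∘-resp-≈ʳ project₁)
    }

  id-rep : 𝒱.id represents asSub {Γ} (λ i → i)
  id-rep = rep λ i → 𝒱.Equiv.sym 𝒱.identityʳ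

  there-rep : π₁ represents asSub {Γ} {τ ∷ Γ} there
  there-rep = rep λ i → 𝒱.Equiv.refl

  single-rep : (M : Γ ⊢ᵛ τ) → ⟨ 𝒱.id , ⟦ M ⟧ᵛ ⟩ represents single M
  single-rep M = rep λ
    { (here refl) → 𝒱.Equiv.sym project₂
    ; (there i)   → 𝒱.Equiv.sym (𝒱.assoc 𝒱.⊙ 𝒱.∘-resp-≈ʳ project₁ 𝒱.⊙ 𝒱.identityʳ)
    }

  ∘π₁-⊠₁ : ∀ {X Y Z W} {g : X 𝒱.⇒ Y} {f : Z 𝒱.⇒ X} →
           (g 𝒱.∘ f) 𝒱.∘ π₁ 𝒱.≈ (g 𝒱.∘ π₁) 𝒱.∘ (f ⊠₁ 𝒱.id {W})
  ∘π₁-⊠₁ = 𝒱.assoc 𝒱.⊙ 𝒱.∘-resp-≈ʳ (𝒱.Equiv.sym project₁) 𝒱.⊙ 𝒱.Equiv.sym 𝒱.assoc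

  lift-rep : {f : ⟦ Γ′ ⟧* 𝒱.⇒ ⟦ Γ ⟧*} {ρ : Γ ⊆ Γ′} → f represents asSub ρ →
             (f ⊠₁ 𝒱.id) represents asSub (lift {τ = τ} ρ)
  lift-rep r = rep λ
    { (here refl) → 𝒱.Equiv.sym (project₂ 𝒱.⊙ 𝒱.identityˡ)
    ; (there i)   → 𝒱.∘-resp-≈ˡ (at r i) 𝒱.⊙ ∘π₁-⊠₁
    }

  module _ {f : ⟦ Γ′ ⟧* 𝒱.⇒ ⟦ Γ ⟧*} {ρ : Γ ⊆ Γ′} (r : f represents asSub ρ) where
    -- Renaming has to precede substitution, since `liftˢ` weakens the entries of a substitution by
    -- `renᵛ there`.
    ren-⟦⟧ᵛ  : (M : Γ ⊢ᵛ τ) → ⟦ renᵛ ρ M ⟧ᵛ 𝒱.≈ ⟦ M ⟧ᵛ 𝒱.∘ f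
    ren-⟦⟧ᵛ* : (Ms : All (Γ ⊢ᵛ_) τs) → ⟦ ren* ρ Ms ⟧ᵛ* 𝒱.≈ ⟦ Ms ⟧ᵛ* 𝒱.∘ f

    ren-⟦⟧ᵛ (var i)    = at r i
    ren-⟦⟧ᵛ (fun g Ms) = 𝒱.∘-resp-≈ʳ (ren-⟦⟧ᵛ* Ms) 𝒱.⊙ 𝒱.Equiv.sym 𝒱.assoc
    ren-⟦⟧ᵛ (pair M N) = ⟨⟩-cong (ren-⟦⟧ᵛ M) (ren-⟦⟧ᵛ N) 𝒱.⊙ 𝒱.Equiv.sym ⟨⟩∘
    ren-⟦⟧ᵛ (fst M)    = 𝒱.∘-resp-≈ʳ (ren-⟦⟧ᵛ M) 𝒱.⊙ 𝒱.Equiv.sym 𝒱.assoc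
    ren-⟦⟧ᵛ (snd M)    = 𝒱.∘-resp-≈ʳ (ren-⟦⟧ᵛ M) 𝒱.⊙ 𝒱.Equiv.sym 𝒱.assoc
    ren-⟦⟧ᵛ unit       = !-unique₂

    ren-⟦⟧ᵛ* []       = !-unique₂
    ren-⟦⟧ᵛ* (M ∷ Ms) = ⟨⟩-cong (ren-⟦⟧ᵛ* Ms) (ren-⟦⟧ᵛ M) 𝒱.⊙ 𝒱.Equiv.sym ⟨⟩∘

  liftˢ-rep : {f : ⟦ Γ′ ⟧* 𝒱.⇒ ⟦ Γ ⟧*} {θ : Sub Γ Γ′} → f represents θ →
              (f ⊠₁ 𝒱.id) represents liftˢ {τ = τ} θ
  liftˢ-rep {θ = θ} r = rep λ
    { (here refl) → 𝒱.Equiv.sym (project₂ 𝒱.⊙ 𝒱.identityˡ)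
    ; (there i)   → ren-⟦⟧ᵛ there-rep (θ i) 𝒱.⊙ 𝒱.∘-resp-≈ˡ (at r i) 𝒱.⊙ ∘π₁-⊠₁
    }

  module _ {f : ⟦ Γ′ ⟧* 𝒱.⇒ ⟦ Γ ⟧*} {θ : Sub Γ Γ′} (r : f represents θ) where
    sub-⟦⟧ᵛ  : (M : Γ ⊢ᵛ τ) → ⟦ subᵛ θ M ⟧ᵛ 𝒱.≈ ⟦ M ⟧ᵛ 𝒱.∘ f
    sub-⟦⟧ᵛ* : (Ms : All (Γ ⊢ᵛ_) τs) → ⟦ sub* θ Ms ⟧ᵛ* 𝒱.≈ ⟦ Ms ⟧ᵛ* 𝒱.∘ f

    sub-⟦⟧ᵛ (var i)    = at r i
    sub-⟦⟧ᵛ (fun g Ms) = 𝒱.∘-resp-≈ʳ (sub-⟦⟧ᵛ* Ms) 𝒱.⊙ 𝒱.Equiv.sym 𝒱.assoc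
    sub-⟦⟧ᵛ (pair M N) = ⟨⟩-cong (sub-⟦⟧ᵛ M) (sub-⟦⟧ᵛ N) 𝒱.⊙ 𝒱.Equiv.sym ⟨⟩∘
    sub-⟦⟧ᵛ (fst M)    = 𝒱.∘-resp-≈ʳ (sub-⟦⟧ᵛ M) 𝒱.⊙ 𝒱.Equiv.sym 𝒱.assoc
    sub-⟦⟧ᵛ (snd M)    = 𝒱.∘-resp-≈ʳ (sub-⟦⟧ᵛ M) 𝒱.⊙ 𝒱.Equiv.sym 𝒱.assoc
    sub-⟦⟧ᵛ unit       = !-unique₂

    sub-⟦⟧ᵛ* []       = !-unique₂
    sub-⟦⟧ᵛ* (M ∷ Ms) = ⟨⟩-cong (sub-⟦⟧ᵛ* Ms) (sub-⟦⟧ᵛ M) 𝒱.⊙ 𝒱.Equiv.sym ⟨⟩∘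

  -- The value arguments join the function symbol in the left operand, which leaves only the
  -- computation on the right, so that the laws of `⋆` apply.
  cfun-comp : (g : Fun (τs ⨾ A ⟶ᶜ B)) (Ms : All (Γ ⊢ᵛ_) τs) (N : Γ ∣ Δ ⊢ᶜ A) →
              ⟦ cfun g Ms N ⟧ᶜ ≈ (⟦cfun⟧ g ∘ (⟦ Ms ⟧ᵛ* ·₁ id)) ⋆[ Γ ∣ Δ ] ⟦ N ⟧ᶜ
  cfun-comp g Ms N = ∘-resp-≈ʳ (∘-resp-≈ˡ (Equiv.sym ·-split₁₂) ⊙ assoc) ⊙ Equiv.sym assoc

  letval-comp : (N : Γ ∣ Δ ⊢ᶜ ▷ τ) (Q : τ ∷ Γ ∣ nothing ⊢ᶜ A) →
                ⟦ letval N Q ⟧ᶜ ≈ (⟦ Q ⟧ᶜ ∘ φ _ _) ⋆[ Γ ∣ Δ ] ⟦ N ⟧ᶜ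
  letval-comp N Q = Equiv.sym assoc

  -- Renaming and substitution act alike on every term former. The cases are therefore stated for
  -- arbitrary primed subterms whose meanings are related by f, and serve both inductions.
  module Reindexing (Γ′ Γ : VCtx) (f : ⟦ Γ′ ⟧* 𝒱.⇒ ⟦ Γ ⟧*) where
    private
      f* : ∀ Δ → ⟦ Γ′ ∣ Δ ⟧ ⇒ ⟦ Γ ∣ Δ ⟧
      f* Δ = reindex Γ′ Γ Δ f

    cvar-reindex : ∀ A → ⟦ cvar {Γ = Γ′} {A = A} ⟧ᶜ ≈ ⟦ cvar {Γ = Γ} {A = A} ⟧ᶜ ∘ f* (just A)
    cvar-reindex A = ∘-resp-≈ʳ (·-cong !-unique₂ Equiv.refl ⊙ Equiv.sym ·-∘ˡ) ⊙ Equiv.sym assoc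

    cfun-reindex : (g : Fun (τs ⨾ A ⟶ᶜ B))
                   (Ms : All (Γ ⊢ᵛ_) τs) (N : Γ ∣ Δ ⊢ᶜ A)
                   (Ms′ : All (Γ′ ⊢ᵛ_) τs) (N′ : Γ′ ∣ Δ ⊢ᶜ A) →
                   ⟦ Ms′ ⟧ᵛ* 𝒱.≈ ⟦ Ms ⟧ᵛ* 𝒱.∘ f → ⟦ N′ ⟧ᶜ ≈ ⟦ N ⟧ᶜ ∘ f* Δ →
                   ⟦ cfun g Ms′ N′ ⟧ᶜ ≈ ⟦ cfun g Ms N ⟧ᶜ ∘ f* Δ
    cfun-reindex {Δ = Δ} g Ms N Ms′ N′ p q = begin
      ⟦ cfun g Ms′ N′ ⟧ᶜ
        ≈⟨ cfun-comp g Ms′ N′ ⟩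
      (⟦cfun⟧ g ∘ (⟦ Ms′ ⟧ᵛ* ·₁ id)) ⋆[ Γ′ ∣ Δ ] ⟦ N′ ⟧ᶜ
        ≈⟨ comp-resp-≈ Γ′ Δ
             (∘-resp-≈ʳ (·-cong p Equiv.refl ⊙ Equiv.sym ·-∘ˡ) ⊙ Equiv.sym assoc) q ⟩
      ((⟦cfun⟧ g ∘ (⟦ Ms ⟧ᵛ* ·₁ id)) ∘ (f ·₁ id)) ⋆[ Γ′ ∣ Δ ] (⟦ N ⟧ᶜ ∘ f* Δ)
        ≈⟨ comp-reindex Γ′ Γ Δ f ⟨
      ((⟦cfun⟧ g ∘ (⟦ Ms ⟧ᵛ* ·₁ id)) ⋆[ Γ ∣ Δ ] ⟦ N ⟧ᶜ) ∘ f* Δ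
        ≈⟨ ∘-resp-≈ˡ (cfun-comp g Ms N) ⟨
      ⟦ cfun g Ms N ⟧ᶜ ∘ f* Δ ∎

    gen-reindex : (h : Fun (τs ⟶ᶜ A)) (Ms : All (Γ ⊢ᵛ_) τs) (Ms′ : All (Γ′ ⊢ᵛ_) τs) →
                  ⟦ Ms′ ⟧ᵛ* 𝒱.≈ ⟦ Ms ⟧ᵛ* 𝒱.∘ f →
                  ⟦ gen h Ms′ ⟧ᶜ ≈ ⟦ gen h Ms ⟧ᶜ ∘ f* nothing
    gen-reindex h Ms Ms′ p = ∘-resp-≈ʳ (F.F-resp-≈ p ⊙ F.homomorphism) ⊙ Equiv.sym assoc

    letval-reindex : (N : Γ ∣ Δ ⊢ᶜ ▷ τ) (Q : τ ∷ Γ ∣ nothing ⊢ᶜ A)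
                     (N′ : Γ′ ∣ Δ ⊢ᶜ ▷ τ) (Q′ : τ ∷ Γ′ ∣ nothing ⊢ᶜ A) →
                     ⟦ N′ ⟧ᶜ ≈ ⟦ N ⟧ᶜ ∘ f* Δ → ⟦ Q′ ⟧ᶜ ≈ ⟦ Q ⟧ᶜ ∘ F₁ (f ⊠₁ 𝒱.id) →
                     ⟦ letval N′ Q′ ⟧ᶜ ≈ ⟦ letval N Q ⟧ᶜ ∘ f* Δ
    letval-reindex {Δ = Δ} N Q N′ Q′ p q = begin
      ⟦ letval N′ Q′ ⟧ᶜ
        ≈⟨ letval-comp N′ Q′ ⟩
      (⟦ Q′ ⟧ᶜ ∘ φ _ _) ⋆[ Γ′ ∣ Δ ] ⟦ N′ ⟧ᶜ
        ≈⟨ comp-resp-≈ Γ′ Δ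
             -- Naturality of `φ` in the context turns the lifted `f ⊠₁ id` into f acting outside
             -- the binder.
             (∘-resp-≈ˡ q ⊙ assoc ⊙ ∘-resp-≈ʳ (F.φ-naturalˡ f) ⊙ Equiv.sym assoc) p ⟩
      ((⟦ Q ⟧ᶜ ∘ φ _ _) ∘ (f ·₁ id)) ⋆[ Γ′ ∣ Δ ] (⟦ N ⟧ᶜ ∘ f* Δ)
        ≈⟨ comp-reindex Γ′ Γ Δ f ⟨
      ((⟦ Q ⟧ᶜ ∘ φ _ _) ⋆[ Γ ∣ Δ ] ⟦ N ⟧ᶜ) ∘ f* Δ
        ≈⟨ ∘-resp-≈ˡ (letval-comp N Q) ⟨
      ⟦ letval N Q ⟧ᶜ ∘ f* Δ ∎

  open Reindexing

  ren-⟦⟧ᶜ : {f : ⟦ Γ′ ⟧* 𝒱.⇒ ⟦ Γ ⟧*} {ρ : Γ ⊆ Γ′} → f represents asSub ρ →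
            (N : Γ ∣ Δ ⊢ᶜ A) → ⟦ renᶜ ρ N ⟧ᶜ ≈ ⟦ N ⟧ᶜ ∘ reindex Γ′ Γ Δ f
  ren-⟦⟧ᶜ {Γ′} {Γ} {f = f} r (cvar {A = A}) = cvar-reindex Γ′ Γ f A
  ren-⟦⟧ᶜ {Γ′} {Γ} {f = f} {ρ} r (cfun g Ms N) =
    cfun-reindex Γ′ Γ f g Ms N (ren* ρ Ms) (renᶜ ρ N)
      (ren-⟦⟧ᵛ* r Ms) (ren-⟦⟧ᶜ r N)
  ren-⟦⟧ᶜ {Γ′} {Γ} {f = f} {ρ} r (gen h Ms) =
    gen-reindex Γ′ Γ f h Ms (ren* ρ Ms) (ren-⟦⟧ᵛ* r Ms)
  ren-⟦⟧ᶜ r (val M) = F.F-resp-≈ (ren-⟦⟧ᵛ r M) ⊙ F.homomorphism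
  ren-⟦⟧ᶜ {Γ′} {Γ} {f = f} {ρ} r (letval N Q) =
    letval-reindex Γ′ Γ f N Q (renᶜ ρ N) (renᶜ (lift ρ) Q)
      (ren-⟦⟧ᶜ r N) (ren-⟦⟧ᶜ (lift-rep r) Q)

  sub-⟦⟧ᶜ : {f : ⟦ Γ′ ⟧* 𝒱.⇒ ⟦ Γ ⟧*} {θ : Sub Γ Γ′} → f represents θ →
            (N : Γ ∣ Δ ⊢ᶜ A) → ⟦ subᶜ θ N ⟧ᶜ ≈ ⟦ N ⟧ᶜ ∘ reindex Γ′ Γ Δ f
  sub-⟦⟧ᶜ {Γ′} {Γ} {f = f} r (cvar {A = A}) = cvar-reindex Γ′ Γ f A
  sub-⟦⟧ᶜ {Γ′} {Γ} {f = f} {θ} r (cfun g Ms N) =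
    cfun-reindex Γ′ Γ f g Ms N (sub* θ Ms) (subᶜ θ N)
      (sub-⟦⟧ᵛ* r Ms) (sub-⟦⟧ᶜ r N)
  sub-⟦⟧ᶜ {Γ′} {Γ} {f = f} {θ} r (gen h Ms) =
    gen-reindex Γ′ Γ f h Ms (sub* θ Ms) (sub-⟦⟧ᵛ* r Ms)
  sub-⟦⟧ᶜ r (val M) = F.F-resp-≈ (sub-⟦⟧ᵛ r M) ⊙ F.homomorphism
  sub-⟦⟧ᶜ {Γ′} {Γ} {f = f} {θ} r (letval N Q) =
    letval-reindex Γ′ Γ f N Q (subᶜ θ N) (subᶜ (liftˢ θ) Q)
      (sub-⟦⟧ᶜ r N) (sub-⟦⟧ᶜ (liftˢ-rep r) Q)

  -- The computation variable is the unit of `⋆`. In the other cases the meaning of the term is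
  -- itself a `⋆ᶠ` composite ending in E, so associativity applies.
  plug-⟦⟧ᶜ : (E : Γ ∣ just A ⊢ᶜ B) (N : Γ ∣ Δ ⊢ᶜ A) →
             ⟦ E [ N ]ᶜ ⟧ᶜ ≈ ⟦ E ⟧ᶜ ⋆[ Γ ∣ Δ ] ⟦ N ⟧ᶜ
  plug-⟦⟧ᶜ {Γ} {Δ = Δ} cvar N = Equiv.sym (comp-identityˡ Γ Δ)
  plug-⟦⟧ᶜ {Γ} {Δ = Δ} (cfun g Ms E) N =
    cfun-comp g Ms (E [ N ]ᶜ)
    ⊙ comp-resp-≈ Γ Δ Equiv.refl (plug-⟦⟧ᶜ E N)
    ⊙ comp-assoc Γ Δ
    ⊙ comp-resp-≈ Γ Δ (Equiv.sym (cfun-comp g Ms E)) Equiv.refl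
  plug-⟦⟧ᶜ {Γ} {Δ = Δ} (letval E Q) N =
    letval-comp (E [ N ]ᶜ) Q
    ⊙ comp-resp-≈ Γ Δ Equiv.refl (plug-⟦⟧ᶜ E N)
    ⊙ comp-assoc Γ Δ
    ⊙ comp-resp-≈ Γ Δ (Equiv.sym (letval-comp E Q)) Equiv.refl

  -- The laws of let val.

  sound-β : (M : Γ ⊢ᵛ τ) (N : τ ∷ Γ ∣ nothing ⊢ᶜ A) →
            ⟦ letval (val M) N ⟧ᶜ ≈ ⟦ N [ M ]ᵛ ⟧ᶜ
  sound-β M N = begin
    ⟦ N ⟧ᶜ ∘ (φ _ _ ∘ ((𝒱.id ·₁ F₁ ⟦ M ⟧ᵛ) ∘ (φ⁻¹ _ _ ∘ F₁ δ)))
      -- Naturality carries the `φ⁻¹` of `d` past M, where it cancels the `φ` of the let; the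
      -- remaining pairing represents `single M`.
      ≈⟨ ∘-resp-≈ʳ (∘-resp-≈ʳ (extendʳ (F.φ⁻¹-natural 𝒱.id ⟦ M ⟧ᵛ))) ⟩
    ⟦ N ⟧ᶜ ∘ (φ _ _ ∘ (φ⁻¹ _ _ ∘ (F₁ (𝒱.id ⊠₁ ⟦ M ⟧ᵛ) ∘ F₁ δ)))
      ≈⟨ ∘-resp-≈ʳ (cancelˡ (Iso.isoʳ (φ-iso _ _))) ⟩
    ⟦ N ⟧ᶜ ∘ (F₁ (𝒱.id ⊠₁ ⟦ M ⟧ᵛ) ∘ F₁ δ)
      ≈⟨ ∘-resp-≈ʳ (Equiv.sym F.homomorphism ⊙ F.F-resp-≈ ⊠₁∘δ) ⟩
    ⟦ N ⟧ᶜ ∘ F₁ ⟨ 𝒱.id , ⟦ M ⟧ᵛ ⟩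
      ≈⟨ sub-⟦⟧ᶜ (single-rep M) N ⟨
    ⟦ N [ M ]ᵛ ⟧ᶜ ∎

  sound-η : (N : Γ ∣ Δ ⊢ᶜ ▷ τ) → ⟦ letval N (val (var (here refl))) ⟧ᶜ ≈ ⟦ N ⟧ᶜ
  sound-η {Γ} {Δ} N =
    letval-comp N (val (var (here refl)))
    ⊙ comp-resp-≈ Γ Δ F.π₂-φ Equiv.refl ⊙ comp-identityˡ Γ Δ

  -- The common core of both commuting conversions: associativity brings k next to the body, and
  -- `⋆ᶠ-φ` takes it under the binder. Here k is an outer let body for `letval-assoc` and a term
  -- with a computation variable for `sound-commute-arg`.
  comp-letval-body : {k : ⟦ Γ ⟧* ·₀ ⟦ B ⟧ᵀ ⇒ ⟦ A ⟧ᵀ}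
                     (N : Γ ∣ Δ ⊢ᶜ ▷ τ) (Q : τ ∷ Γ ∣ nothing ⊢ᶜ B) (R : τ ∷ Γ ∣ nothing ⊢ᶜ A) →
                     ⟦ R ⟧ᶜ ≈ (k ∘ (π₁ ·₁ id)) ⋆[ τ ∷ Γ ∣ nothing ] ⟦ Q ⟧ᶜ →
                     k ⋆[ Γ ∣ Δ ] ⟦ letval N Q ⟧ᶜ ≈ ⟦ letval N R ⟧ᶜ
  comp-letval-body {Γ = Γ} {Δ = Δ} N Q R p =
    comp-resp-≈ Γ Δ Equiv.refl (letval-comp N Q)
    ⊙ comp-assoc Γ Δ
    ⊙ comp-resp-≈ Γ Δ (F.⋆ᶠ-φ ⊙ ∘-resp-≈ˡ (Equiv.sym p)) Equiv.refl
    ⊙ Equiv.sym (letval-comp N R)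

  letval-resp-≈ : {N N′ : Γ ∣ Δ ⊢ᶜ ▷ τ} {Q Q′ : τ ∷ Γ ∣ nothing ⊢ᶜ A} →
                  ⟦ N ⟧ᶜ ≈ ⟦ N′ ⟧ᶜ → ⟦ Q ⟧ᶜ ≈ ⟦ Q′ ⟧ᶜ → ⟦ letval N Q ⟧ᶜ ≈ ⟦ letval N′ Q′ ⟧ᶜ
  letval-resp-≈ p q =
    ∘-resp-≈ q (∘-resp-≈ʳ (∘-resp-≈ˡ (·-cong 𝒱.Equiv.refl p)))

  -- Here k is the meaning of R after `φ`. Weakening k along `π₁` passes through `φ` by naturality
  -- and becomes the weakening of R beneath its own variable.
  letval-assoc : (N : Γ ∣ Δ ⊢ᶜ ▷ σ) (Q : σ ∷ Γ ∣ nothing ⊢ᶜ ▷ τ) (R : τ ∷ Γ ∣ nothing ⊢ᶜ A) →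
                 ⟦ letval (letval N Q) R ⟧ᶜ ≈ ⟦ letval N (letval Q (renᶜ (lift there) R)) ⟧ᶜ
  letval-assoc {Γ} {σ = σ} N Q R =
    letval-comp (letval N Q) R
    ⊙ comp-letval-body N Q (letval Q R′) (begin
        ⟦ letval Q R′ ⟧ᶜ
          ≈⟨ letval-comp Q R′ ⟩
        (⟦ R′ ⟧ᶜ ∘ φ _ _) ⋆[ σ ∷ Γ ∣ nothing ] ⟦ Q ⟧ᶜ
          ≈⟨ comp-resp-≈ (σ ∷ Γ) nothing
               (∘-resp-≈ˡ (ren-⟦⟧ᶜ (lift-rep there-rep) R) ⊙ assoc
                 ⊙ ∘-resp-≈ʳ (F.φ-naturalˡ π₁) ⊙ Equiv.sym assoc)
               Equiv.refl ⟩
        ((⟦ R ⟧ᶜ ∘ φ _ _) ∘ (π₁ ·₁ id)) ⋆[ σ ∷ Γ ∣ nothing ] ⟦ Q ⟧ᶜ ∎)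
    where
    R′ = renᶜ (lift there) R

  -- For the induction on C, the weakening of N₂ is only specified up to its
  -- meaning.
  commute-up-to : (C : Context Γ′ Δ′ Γ Δ) (N₁ : Γ′ ∣ Δ′ ⊢ᶜ ▷ τ)
                  (N₂ : τ ∷ Γ ∣ nothing ⊢ᶜ A) (R : τ ∷ Γ′ ∣ nothing ⊢ᶜ A) →
                  (∀ {f} → f represents asSub (bound C) → ⟦ R ⟧ᶜ ≈ ⟦ N₂ ⟧ᶜ ∘ F₁ (f ⊠₁ 𝒱.id)) →
                  ⟦ letval (plug C N₁) N₂ ⟧ᶜ ≈ ⟦ plug C (letval N₁ R) ⟧ᶜ
  commute-up-to hole N₁ N₂ R p =
    letval-resp-≈ {N = N₁} {N₁} {N₂} {R} Equiv.refl (Equiv.sym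
      (p id-rep
       ⊙ ∘-resp-≈ʳ (F.F-resp-≈ (Functor.identity (Monoidal.tensor (cartesian P))) ⊙ F.identity)
       ⊙ identityʳ))
  commute-up-to (letval-in N C) N₁ N₂ R p =
    letval-assoc N (plug C N₁) N₂
    ⊙ letval-resp-≈ {N = N} {N} {letval (plug C N₁) N₂′} {plug C (letval N₁ R)} Equiv.refl
        (commute-up-to C N₁ N₂′ R λ {f} r → begin
          ⟦ R ⟧ᶜ
            ≈⟨ p {π₁ 𝒱.∘ f} (rep λ i → at r (there i) 𝒱.⊙ 𝒱.assoc) ⟩
          ⟦ N₂ ⟧ᶜ ∘ F₁ ((π₁ 𝒱.∘ f) ⊠₁ 𝒱.id)
            ≈⟨ ∘-resp-≈ʳ (F.F-resp-≈ (∘-⊠₁-id f) ⊙ F.homomorphism) ⟩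
          ⟦ N₂ ⟧ᶜ ∘ (F₁ (π₁ ⊠₁ 𝒱.id) ∘ F₁ (f ⊠₁ 𝒱.id))
            ≈⟨ pullˡ (Equiv.sym (ren-⟦⟧ᶜ (lift-rep there-rep) N₂)) ⟩
          ⟦ N₂′ ⟧ᶜ ∘ F₁ (f ⊠₁ 𝒱.id) ∎)
    where
    N₂′ = renᶜ (lift there) N₂

    ∘-⊠₁-id : ∀ {X Y Z W} {g : Y 𝒱.⇒ Z} (f : X 𝒱.⇒ Y) →
              (g 𝒱.∘ f) ⊠₁ 𝒱.id {W} 𝒱.≈ (g ⊠₁ 𝒱.id) 𝒱.∘ (f ⊠₁ 𝒱.id)
    ∘-⊠₁-id f = 𝒱.Equiv.sym (⊠₁∘⟨⟩ 𝒱.⊙ ⟨⟩-cong (𝒱.Equiv.sym 𝒱.assoc) 𝒱.identityˡ)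

  -- `plug-⟦⟧ᶜ` turns both substitutions into `⋆`, and the meaning of E plays the role of k;
  -- weakening E supplies the required `π₁`.
  sound-commute-arg : (E : Γ ∣ just B ⊢ᶜ A) (N₁ : Γ ∣ Δ ⊢ᶜ ▷ τ) (N₂ : τ ∷ Γ ∣ nothing ⊢ᶜ B) →
                      ⟦ E [ letval N₁ N₂ ]ᶜ ⟧ᶜ ≈ ⟦ letval N₁ (renᶜ there E [ N₂ ]ᶜ) ⟧ᶜ
  sound-commute-arg {Γ} {τ = τ} E N₁ N₂ =
    plug-⟦⟧ᶜ E (letval N₁ N₂)
    ⊙ comp-letval-body N₁ N₂ (renᶜ there E [ N₂ ]ᶜ)
        (plug-⟦⟧ᶜ (renᶜ there E) N₂
         ⊙ comp-resp-≈ (τ ∷ Γ) nothing (ren-⟦⟧ᶜ there-rep E) Equiv.refl)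

  lookup-ext : (Ms Ns : All (Γ ⊢ᵛ_) τs) →
               (∀ {τ} (i : τ ∈ τs) → ⟦ lookup Ms i ⟧ᵛ 𝒱.≈ ⟦ lookup Ns i ⟧ᵛ) →
               ⟦ Ms ⟧ᵛ* 𝒱.≈ ⟦ Ns ⟧ᵛ*
  lookup-ext []       []       p = 𝒱.Equiv.refl
  lookup-ext (M ∷ Ms) (N ∷ Ns) p =
    ⟨⟩-cong (lookup-ext Ms Ns (λ i → p (there i))) (p (here refl))

  unsatᵛ : {M N : Γ ⊢ᵛ τ} → Satisfied (M ≐ᵛ N) → ⟦ M ⟧ᵛ 𝒱.≈ ⟦ N ⟧ᵛ
  unsatᵛ (sat-v p) = p

  unsatᶜ : {M N : Γ ∣ Δ ⊢ᶜ A} → Satisfied (M ≐ᶜ N) → ⟦ M ⟧ᶜ ≈ ⟦ N ⟧ᶜ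
  unsatᶜ (sat-c p) = p

-- Induction on derivations.

module _
  {s a o ℓ e o′ ℓ′ e′ : Level} (T : Theory s a)
  {𝒱 : Category o ℓ e} (P : FiniteProducts 𝒱)
  {𝒞 : Category o′ ℓ′ e′} (𝒜 : Action (cartesian P) 𝒞)
  {F : Functor 𝒱 𝒞} (Φ : StrongEquivariant (selfAction (cartesian P)) 𝒜 F)
  (I : Semantics.Interpretation (Theory.signature T) P 𝒜 Φ)
  where

  open Theory T
  open Derivability T
  open Semantics.Interpretation I
  open Soundness signature P 𝒜 Φ I
  open ProductLemmas P using (⟨⟩-cong; !-unique₂)
  open ActionLemmas P 𝒜 using (·-cong)
  private
    module 𝒱 where
      open Category 𝒱 public
      open CategoryLemmas 𝒱 public
      open FiniteProducts P public
    module 𝒞 where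
      open Category 𝒞 public
      open CategoryLemmas 𝒞 public
    module F = Functor F

  module _ (axioms : ∀ E → Axiom E → Satisfied E) where
    -- No rule concluding a value equation has a computation equation among its premises, so this
    -- induction closes by itself and `soundᶜ` can call it.
    soundᵛ : ∀ {Γ τ} {M N : Γ ⊢ᵛ τ} → Derivable (M ≐ᵛ N) → ⟦ M ⟧ᵛ 𝒱.≈ ⟦ N ⟧ᵛ
    soundᵛ (axiom x)        = unsatᵛ (axioms _ x)
    soundᵛ reflᵛ            = 𝒱.Equiv.refl
    soundᵛ (symᵛ p)         = 𝒱.Equiv.sym (soundᵛ p)
    soundᵛ (transᵛ p q)     = 𝒱.Equiv.trans (soundᵛ p) (soundᵛ q)
    soundᵛ (fun-cong {Ms = Ms} {Ns} ps) =
      𝒱.∘-resp-≈ʳ (lookup-ext Ms Ns (λ i → soundᵛ (ps i)))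
    soundᵛ (pair-cong p q)  = ⟨⟩-cong (soundᵛ p) (soundᵛ q)
    soundᵛ (fst-cong p)     = 𝒱.∘-resp-≈ʳ (soundᵛ p)
    soundᵛ (snd-cong p)     = 𝒱.∘-resp-≈ʳ (soundᵛ p)
    soundᵛ (subst-vv {Γ = Γ} {M = M} {N} {θ} {θ′} p ps) with representative Γ θ
    ... | f , r =
      sub-⟦⟧ᵛ r M 𝒱.⊙ 𝒱.∘-resp-≈ˡ (soundᵛ p)
      𝒱.⊙ 𝒱.Equiv.sym (sub-⟦⟧ᵛ {θ = θ′}
            -- The representative of θ also represents θ′, because the premises identify their
            -- entries in the model.
            (rep λ i → 𝒱.Equiv.sym (soundᵛ (ps i)) 𝒱.⊙ _represents_.at r i) N)
    soundᵛ ×-β₁             = 𝒱.project₁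
    soundᵛ ×-β₂             = 𝒱.project₂
    soundᵛ ×-η              = 𝒱.Equiv.sym (𝒱.unique 𝒱.Equiv.refl 𝒱.Equiv.refl)
    soundᵛ 1-η              = !-unique₂

    soundᶜ : ∀ {Γ Δ A} {M N : Γ ∣ Δ ⊢ᶜ A} → Derivable (M ≐ᶜ N) → ⟦ M ⟧ᶜ 𝒞.≈ ⟦ N ⟧ᶜ
    soundᶜ (axiom x)      = unsatᶜ (axioms _ x)
    soundᶜ reflᶜ          = 𝒞.Equiv.refl
    soundᶜ (symᶜ p)       = 𝒞.Equiv.sym (soundᶜ p)
    soundᶜ (transᶜ p q)   = 𝒞.Equiv.trans (soundᶜ p) (soundᶜ q)
    soundᶜ (cfun-cong {Ms = Ms} {Ns} ps q) =
      𝒞.∘-resp-≈ʳ (𝒞.∘-resp-≈ˡ (·-cong (lookup-ext Ms Ns (λ i → soundᵛ (ps i))) (soundᶜ q)))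
    soundᶜ (gen-cong {Ms = Ms} {Ns} ps) =
      𝒞.∘-resp-≈ʳ (F.F-resp-≈ (lookup-ext Ms Ns (λ i → soundᵛ (ps i))))
    soundᶜ (val-cong p)   = F.F-resp-≈ (soundᵛ p)
    soundᶜ (letval-cong {P = N} {N′} {Q} {Q′} p q) =
      letval-resp-≈ {N = N} {N′} {Q} {Q′} (soundᶜ p) (soundᶜ q)
    soundᶜ (subst-vc {Γ = Γ} {P = M} {N} {θ} {θ′} p ps) with representative Γ θ
    ... | f , r =
      sub-⟦⟧ᶜ r M 𝒞.⊙ 𝒞.∘-resp-≈ˡ (soundᶜ p)
      𝒞.⊙ 𝒞.Equiv.sym (sub-⟦⟧ᶜ {θ = θ′}
            (rep λ i → 𝒱.Equiv.sym (soundᵛ (ps i)) 𝒱.⊙ _represents_.at r i) N)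
    soundᶜ (subst-cc {Γ = Γ} {Δ = Δ} {P = E} {E′} {N} {N′} p q) =
      plug-⟦⟧ᶜ E N 𝒞.⊙ comp-resp-≈ Γ Δ (soundᶜ p) (soundᶜ q)
      𝒞.⊙ 𝒞.Equiv.sym (plug-⟦⟧ᶜ E′ N′)
    soundᶜ (let-β {M = M} {N}) = sound-β M N
    soundᶜ (let-η {N = N})     = sound-η N
    soundᶜ (commute C {N₁} {N₂}) =
      -- The actual weakening has the required meaning under every representative of `bound C`, by
      -- the renaming lemma.
      commute-up-to C N₁ N₂ (renᶜ (lift (bound C)) N₂) (λ r → ren-⟦⟧ᶜ (lift-rep r) N₂)
    soundᶜ (commute-arg E {N₁} {N₂}) = sound-commute-arg E N₁ N₂

theorem8 :
    ∀ {s a o ℓ e o′ ℓ′ e′}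
      (T : Theory s a)
      (𝒱 : Category o ℓ e) (P : FiniteProducts 𝒱)
      (𝒞 : Category o′ ℓ′ e′) (𝒜 : Action (cartesian P) 𝒞)
      (F : Functor 𝒱 𝒞) (Φ : StrongEquivariant (selfAction (cartesian P)) 𝒜 F)
      (I : Semantics.Interpretation (Theory.signature T) P 𝒜 Φ) →
    let open Theory T
        open Derivability T
        open Semantics.Interpretation I
    in (∀ E → Axiom E → Satisfied E) →
       ∀ E → Derivable E → Satisfied E
theorem8 T 𝒱 P 𝒞 𝒜 F Φ I axioms (M Syntax.≐ᵛ N) D =
  Semantics.Interpretation.sat-v (soundᵛ T P 𝒜 Φ I axioms D)
theorem8 T 𝒱 P 𝒞 𝒜 F Φ I axioms (M Syntax.≐ᶜ N) D =
  Semantics.Interpretation.sat-c (soundᶜ T P 𝒜 Φ I axioms D)
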